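{- Let $\lambda$ be a regular uncountable cardinal. Assume that $\lambda$ is not Mahlo, or that $\lambda$ is Mahlo and satisfies $\otimes^{\aleph_0}_\lambda$ or $\oplus^{\aleph_0}_\lambda$ (defined in the context). Then $\Pr_7(\lambda,\aleph_0,\aleph_0)$ holds; that is, there is $c:[\lambda]^2\to\omega$ such that (1) for every $A\in[\lambda]^\lambda$ and $n<\omega$ there is $B\in[A]^\lambda$ with $\min \mathrm{Rang}(c\restriction[B]^2)>n$; and moreover (2) if $w_\alpha$ ($\alpha<\lambda$) are pairwise disjoint finite subsets of $\lambda$ and $n<\omega$, then there is $X\in[\lambda]^\lambda$ such that for all $\alpha<\beta$ from $X$, all $i\in w_\alpha$ and all $j\in w_\beta$, $c\{i,j\}\ge n$.
   Context: $[A]^\lambda$ is the family of subsets of $A$ of cardinality $\lambda$; $[A]^2$ is the family of two-element subsets. For a set $C$ of ordinals, $\mathrm{acc}(C)=\{\alpha\in C:\alpha=\sup(\alpha\cap C)\}$ and $\mathrm{nacc}(C)=C\setminus\mathrm{acc}(C)$. "Inaccessible" means weakly inaccessible (uncountable regular limit cardinal); $\lambda$ is Mahlo if it is inaccessible and the set of inaccessibles below $\lambda$ is stationary in $\lambda$. Put $S^\lambda_{\mathrm{in}}=\{\delta<\lambda:\delta\text{ is inaccessible}\}$ and $S^\lambda_{\ge\kappa}=\{\delta<\lambda:\mathrm{cf}(\delta)\ge\kappa\}$. $\otimes^\kappa_\lambda$ (for $\lambda$ Mahlo, $\kappa<\lambda$): there is $\bar C=\langle C_\delta:\delta\in S^\lambda_{\mathrm{in}}\rangle$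 with each $C_\delta$ a club of $\delta$, such that for every club $E$ of $\lambda$ there is $\delta\in\mathrm{acc}(E)\cap S^\lambda_{\mathrm{in}}$ with $\mathrm{cf}(\delta)\ge\kappa$ such that for no $\zeta<\kappa$ and $\alpha_\varepsilon\in S^\lambda_{\mathrm{in}}$ ($\varepsilon<\zeta$) is $(\mathrm{nacc}(E)\cap\delta)\setminus\bigcup_{\varepsilon<\zeta}C_{\alpha_\varepsilon}$ bounded in $\delta$. $\oplus^\kappa_\lambda$ (for $\lambda$ regular uncountable, $\kappa<\lambda$): there is $\bar C=\langle C_\delta:\delta\in S\rangle$, where $S=\{\delta<\lambda:\delta\text{ a limit ordinal}\}$ and each $C_\delta$ is a club of $\delta$, such that for every club $E$ of $\lambda$ there is $\delta\in\mathrm{acc}(E)$ with $\mathrm{cf}(\delta)\ge\kappa$ such that for no $\zeta<\kappa$ and $\alpha_\varepsilon\in S$ ($\varepsilon<\zeta$) is $(S^\lambda_{\ge\kappa}\cap E\cap\delta)\setminus\bigcup_{\varepsilon<\zeta}C_{\alpha_\varepsilon}$ bounded in $\delta$. -}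

module Defs where

open import Level using (Level; _⊔_; suc)
open import Data.Nat as ℕ using (ℕ)
open import Data.List.Base using (List)
open import Data.List.Membership.Propositional using () renaming (_∈_ to _∈ˡ_)
open import Data.Product using (_×_; ∃; ∃-syntax)
open import Data.Sum using (_⊎_)
open import Induction.WellFounded using (WellFounded)
open import Relation.Binary.Core using (Rel)
open import Relation.Binary.Structures using (IsStrictTotalOrder)
open import Relation.Binary.PropositionalEquality using (_≡_; _≢_)
open import Relation.Nullary using (¬_)
open import Relation.Unary using (Pred; _∈_; _∉_; _⊆_; _∩_; U)

private
  variable
    a b p q : Level

-- Equinumerosity of subsets.  The bijection is given by a function on the
-- ambient types, so that it cannot depend on proofs of membership; its
-- values outside P are irrelevant.

Equinumerous : {X : Set a} {Y : Set b} → Pred X p → Pred Y q → Set (a ⊔ b ⊔ p ⊔ q)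
Equinumerous {X = X} {Y = Y} P Q = ∃ λ (f : X → Y) →
    (∀ {x : X} → x ∈ P → f x ∈ Q)
  × (∀ {x y : X} → x ∈ P → y ∈ P → f x ≡ f y → x ≡ y)
  × (∀ {z : Y} → z ∈ Q → ∃[ x ] (x ∈ P × f x ≡ z))

Finite : {X : Set a} → Pred X p → Set (a ⊔ p)
Finite {X = X} P = ∃ λ (xs : List X) → ∀ {x} → x ∈ P → x ∈ˡ xs

PairwiseDisjoint : {X : Set a} {Y : Set b} → Pred X p → (X → Pred Y q) → Set (a ⊔ b ⊔ p ⊔ q)
PairwiseDisjoint {X = X} {Y = Y} I w =
  ∀ {α β : X} → α ∈ I → β ∈ I → α ≢ β → ∀ {x : Y} → x ∈ w α → x ∉ w β

IsMinimum : Pred ℕ p → ℕ → Set p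
IsMinimum P m = m ∈ P × (∀ {k} → k ∈ P → m ℕ.≤ k)

record WellOrder (ℓ : Level) : Set (suc ℓ) where
  infix 4 _<_
  field
    Carrier            : Set ℓ
    _<_                : Rel Carrier ℓ
    isStrictTotalOrder : IsStrictTotalOrder _≡_ _<_
    <-wellFounded      : WellFounded _<_

-- The elements of a well-order W play the role of the ordinals: δ stands for
-- the order type of Below δ.  Every ordinal notion below refers only to
-- ordinals ≤ δ (and to subsets of, and functions on, δ), so it does not
-- depend on how far W extends above δ, and every ordinal μ is an element of
-- some W (for instance of μ + 1).

module Ordinals {ℓ : Level} (W : WellOrder ℓ) where

  open WellOrder W public using (_<_) renaming (Carrier to Ord)

  infix 4 _≤_

  _≤_ : Rel Ord ℓ
  α ≤ β = α < β ⊎ α ≡ β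

  Subset : Set (suc ℓ)
  Subset = Pred Ord ℓ

  Below : Ord → Subset
  Below δ α = α < δ

  -- With these clauses the supremum of the empty set is 0.
  IsSup : Subset → Ord → Set ℓ
  IsSup A σ = (∀ {α} → α ∈ A → α ≤ σ)
            × (∀ β → (∀ {α} → α ∈ A → α ≤ β) → σ ≤ β)

  IsLimit : Ord → Set ℓ
  IsLimit δ = (∃[ α ] α < δ)
            × (∀ {α} → α < δ → ∃[ β ] (α < β × β < δ))

  Bounded : Ord → Subset → Set ℓ
  Bounded δ A = ∃[ γ ] (γ < δ × (∀ {α} → α ∈ A → α ≤ γ))

  acc : Subset → Subset
  acc C α = α ∈ C × IsSup (Below α ∩ C) α

  nacc : Subset → Subset
  nacc C α = α ∈ C × α ∉ acc C

  record IsClub (δ : Ord) (C : Subset) : Set ℓ where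
    field
      subset    : C ⊆ Below δ
      unbounded : ∀ {γ} → γ < δ → ∃[ α ] (α ∈ C × γ ≤ α)
      closed    : ∀ {α} → α < δ → IsLimit α → IsSup (Below α ∩ C) α → α ∈ C

  IsStationary : Ord → Subset → Set (suc ℓ)
  IsStationary δ S = S ⊆ Below δ × (∀ (E : Subset) → IsClub δ E → ∃[ α ] α ∈ S ∩ E)

  -- f, restricted to θ, maps θ cofinally into δ.
  IsCofinalMap : Ord → Ord → (Ord → Ord) → Set ℓ
  IsCofinalMap θ δ f = (∀ {ε} → ε < θ → f ε < δ)
                     × (∀ {γ} → γ < δ → ∃[ ε ] (ε < θ × γ ≤ f ε))

  -- cf(δ) = θ
  IsCofinality : Ord → Ord → Set ℓ
  IsCofinality δ θ = ∃ (IsCofinalMap θ δ)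
                   × (∀ {η} → η < θ → ¬ ∃ (IsCofinalMap η δ))

  -- cf(δ) ≥ κ
  Cf≥ : Ord → Ord → Set ℓ
  Cf≥ κ δ = ∃[ θ ] (IsCofinality δ θ × κ ≤ θ)

  IsCardinal : Ord → Set ℓ
  IsCardinal κ = ∀ {μ} → μ < κ → ¬ Equinumerous (Below μ) (Below κ)

  IsUncountable : Ord → Set ℓ
  IsUncountable κ = ¬ (∃ λ (f : Ord → ℕ) → ∀ {α β} → α < κ → β < κ → f α ≡ f β → α ≡ β)

  IsAleph₀ : Ord → Set ℓ
  IsAleph₀ κ = IsCardinal κ × Equinumerous {X = Ord} {Y = ℕ} (Below κ) U

  -- A ∈ [ X ]^ μ, for a cardinal μ
  [_]^_ : Subset → Ord → Pred Subset ℓ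
  ([ X ]^ μ) A = A ⊆ X × Equinumerous (Below μ) A

  IsRegularUncountable : Ord → Set ℓ
  IsRegularUncountable κ = IsCardinal κ × IsUncountable κ × IsCofinality κ κ

  IsLimitCardinal : Ord → Set ℓ
  IsLimitCardinal κ = IsCardinal κ
    × (∀ {μ} → μ < κ → IsCardinal μ → ∃[ ν ] (IsCardinal ν × μ < ν × ν < κ))

  -- weakly inaccessible
  IsInaccessible : Ord → Set ℓ
  IsInaccessible κ = IsRegularUncountable κ × IsLimitCardinal κ

  Sᵢₙ : Ord → Subset
  Sᵢₙ μ δ = δ < μ × IsInaccessible δ

  Sₗᵢₘ : Ord → Subset
  Sₗᵢₘ μ δ = δ < μ × IsLimit δ

  S≥ : Ord → Ord → Subset
  S≥ κ μ δ = δ < μ × Cf≥ κ δ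

  IsMahlo : Ord → Set (suc ℓ)
  IsMahlo μ = IsInaccessible μ × IsStationary μ (Sᵢₙ μ)

  -- ⟨ C δ : δ ∈ S ⟩ with each C δ a club of δ; C is irrelevant outside S.
  IsClubSequence : Subset → (Ord → Subset) → Set ℓ
  IsClubSequence S C = ∀ {δ} → δ ∈ S → IsClub δ (C δ)

  -- For some ζ < κ and α ε ∈ S (ε < ζ), the set
  -- (A ∩ δ) ∖ ⋃_{ε < ζ} C (α ε) is bounded in δ.
  AlmostCovered : (κ : Ord) (S : Subset) (C : Ord → Subset) (A : Subset) (δ : Ord) → Set ℓ
  AlmostCovered κ S C A δ = ∃[ ζ ] (ζ < κ × (∃ λ (α : Ord → Ord) →
      (∀ {ε} → ε < ζ → α ε ∈ S)
    × Bounded δ (λ x → x ∈ A × x < δ × ¬ (∃[ ε ] (ε < ζ × x ∈ C (α ε))))))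

  ⊗ : (κ μ : Ord) → Set (suc ℓ)
  ⊗ κ μ = ∃ λ (C : Ord → Subset) → (IsClubSequence (Sᵢₙ μ) C
    × (∀ (E : Subset) → IsClub μ E →
         ∃[ δ ] (δ ∈ acc E × δ ∈ Sᵢₙ μ × Cf≥ κ δ
               × ¬ AlmostCovered κ (Sᵢₙ μ) C (nacc E) δ)))

  ⊕ : (κ μ : Ord) → Set (suc ℓ)
  ⊕ κ μ = ∃ λ (C : Ord → Subset) → (IsClubSequence (Sₗᵢₘ μ) C
    × (∀ (E : Subset) → IsClub μ E →
         ∃[ δ ] (δ ∈ acc E × Cf≥ κ δ
               × ¬ AlmostCovered κ (Sₗᵢₘ μ) C (S≥ κ μ ∩ E) δ)))

  -- A colouring of unordered pairs is a symmetric binary function; its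
  -- values on the diagonal (and outside μ) are never used.
  IsPairColouring : Ord → (Ord → Ord → ℕ) → Set ℓ
  IsPairColouring μ c = ∀ {i j} → i < μ → j < μ → i ≢ j → c i j ≡ c j i

  -- Rang(c ↾ [ B ]²)
  RangeOnPairs : (Ord → Ord → ℕ) → Subset → Pred ℕ ℓ
  RangeOnPairs c B k = ∃[ i ] (∃[ j ] (i ∈ B × j ∈ B × i ≢ j × c i j ≡ k))

{-# OPTIONS --safe #-}

-- The colour of a pair α < β is the number ρ α β of steps of Todorcevic's walk
-- from β down to α along a sequence of clubs C.  Call C trivial if for some
-- club D every D ∩ α is contained in some C β with β ≥ α.
--
-- If the colouring fails to be large on a family of finite sets, then by
-- pressing down there is a club D such that for every α some finite F ⊆ [α, μ)
-- contains, for each γ ∈ D ∩ α, a point β with ρ γ β < n.  For a limit γ the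
-- walks to points just below γ follow the walk to γ, so further pressing down
-- first replaces F by a single point and then lowers n, until C is trivial.
--
-- The hypotheses give a nontrivial C.  With ⊕ this is immediate.  Otherwise C β
-- has order type cf β < min (C β) for singular β and avoids the predecessor
-- cardinal and all below for successor β, so that D can only be captured
-- at inaccessible β, where ⊗ applies or, if μ is not Mahlo, C β avoids a fixed club.

module Submission where

open import Defs
open import Axiom.ExcludedMiddle using (ExcludedMiddle)
open import Axiom.DoubleNegationElimination using (em⇒dne)
open import Data.Nat.Induction using () renaming (<-rec to ℕ-rec)
open import Data.Nat as ℕ using (ℕ; zero; suc; _+_)
import Data.Nat.Properties as ℕₚ
open import Data.List.Base using (List; []; _∷_; filter; length)
open import Data.List.Relation.Unary.Any using (here; there)
open import Data.List.Relation.Unary.All using (All; []; _∷_; lookup)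
open import Data.List.Membership.Propositional using () renaming (_∈_ to _∈ˡ_)
open import Data.List.Membership.Propositional.Properties using (∈-filter⁺; ∈-filter⁻)
open import Data.Product using (Σ; _×_; _,_; proj₁; proj₂; ∃; ∃-syntax)
open import Data.Sum using (_⊎_; inj₁; inj₂)
open import Data.Empty using (⊥; ⊥-elim)
open import Function using (_∘_)
open import Induction.WellFounded using (WfRec; module All; module FixPoint)
open import Level as Level using (Level; _⊔_)
open import Relation.Binary.Definitions using (tri<; tri≈; tri>)
open import Relation.Binary.PropositionalEquality using (_≡_; refl; sym; trans; cong; subst)
open import Relation.Binary.Structures using (IsStrictTotalOrder)
open import Relation.Nullary using (¬_; yes; no; contradiction)
open import Relation.Unary using (_∈_; _∉_; _⊆_; _∩_)

-- Classical logic and choice.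

module Classical (em : ∀ {a} → ExcludedMiddle a) where

  dne : ∀ {a} {A : Set a} → ¬ ¬ A → A
  dne = em⇒dne em

  ¬∀⇒∃¬ : ∀ {a p} {A : Set a} {P : A → Set p} → ¬ (∀ x → P x) → ∃ λ x → ¬ P x
  ¬∀⇒∃¬ ¬∀ = dne λ ¬∃ → ¬∀ λ x → dne λ ¬Px → ¬∃ (x , ¬Px)

  -- A witness from `total` may depend on the proof of `P x`; deciding `P x` by `em` fixes one proof
  -- for each point. Outside `P` the value is `b₀`.
  choose : ∀ {a b p q} {A : Set a} {B : Set b} (P : A → Set p) (Q : A → B → Set q) → B →
           (∀ {x} → P x → ∃ (Q x)) → ∃ λ (f : A → B) → ∀ {x} → P x → Q x (f x)
  choose {A = A} {B} P Q b₀ total = proj₁ ∘ pick , λ {x} → proj₂ (pick x)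
    where
    pick : ∀ x → Σ B λ y → P x → Q x y
    pick x with em {P = P x}
    ... | yes Px = proj₁ (total Px) , λ _ → proj₂ (total Px)
    ... | no ¬Px = b₀ , λ Px → contradiction Px ¬Px

-- Well-orders: least elements, limits and gaps in clubs.

module Order (em : ∀ {a} → ExcludedMiddle a) {ℓ : Level} (W : WellOrder ℓ) where

  open Classical em public
  open Ordinals W public
  open WellOrder W public using (isStrictTotalOrder; <-wellFounded)
  open IsStrictTotalOrder isStrictTotalOrder public using (compare)
    renaming (trans to <-trans; irrefl to <-irrefl)

  ≤-refl : ∀ {x} → x ≤ x
  ≤-refl = inj₂ refl

  ≤-<-trans : ∀ {x y z} → x ≤ y → y < z → x < z
  ≤-<-trans (inj₁ x<y)  y<z = <-trans x<y y<z
  ≤-<-trans (inj₂ refl) y<z = y<z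

  <-≤-trans : ∀ {x y z} → x < y → y ≤ z → x < z
  <-≤-trans x<y (inj₁ y<z)  = <-trans x<y y<z
  <-≤-trans x<y (inj₂ refl) = x<y

  ≤-trans : ∀ {x y z} → x ≤ y → y ≤ z → x ≤ z
  ≤-trans (inj₁ x<y)  y≤z = inj₁ (<-≤-trans x<y y≤z)
  ≤-trans (inj₂ refl) y≤z = y≤z

  <⇒≱ : ∀ {x y} → x < y → ¬ y ≤ x
  <⇒≱ x<y y≤x = <-irrefl refl (<-≤-trans x<y y≤x)

  ≮⇒≥ : ∀ {x y} → ¬ x < y → y ≤ x
  ≮⇒≥ {x} {y} x≮y with compare x y
  ... | tri< x<y _ _ = contradiction x<y x≮y
  ... | tri≈ _ x≡y _ = inj₂ (sym x≡y)
  ... | tri> _ _ y<x = inj₁ y<x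

  ≰⇒> : ∀ {x y} → ¬ x ≤ y → y < x
  ≰⇒> x≰y = dne λ y≮x → x≰y (≮⇒≥ y≮x)

  ≤-antisym : ∀ {x y} → x ≤ y → y ≤ x → x ≡ y
  ≤-antisym (inj₁ x<y)  y≤x = contradiction y≤x (<⇒≱ x<y)
  ≤-antisym (inj₂ x≡y) _   = x≡y

  infixl 6 _∨_
  _∨_ : Ord → Ord → Ord
  x ∨ y with em {P = x < y}
  ... | yes _ = y
  ... | no  _ = x

  x≤x∨y : ∀ x y → x ≤ x ∨ y
  x≤x∨y x y with em {P = x < y}
  ... | yes x<y = inj₁ x<y
  ... | no  _   = ≤-refl

  y≤x∨y : ∀ x y → y ≤ x ∨ y
  y≤x∨y x y with em {P = x < y}
  ... | yes _   = ≤-refl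
  ... | no  x≮y = ≮⇒≥ x≮y

  ∨-lub : ∀ {x y z} → x < z → y < z → x ∨ y < z
  ∨-lub {x} {y} x<z y<z with em {P = x < y}
  ... | yes _ = y<z
  ... | no  _ = x<z

  list-bounded : ∀ (Q : Ord → Ord → Set ℓ) {γ} → (∀ {ε ε′ x} → ε ≤ ε′ → Q ε x → Q ε′ x) →
    ∃[ α ] α < γ → ∀ xs → (∀ {x} → x ∈ˡ xs → ∃[ ε ] (ε < γ × Q ε x)) →
    ∃[ ε ] (ε < γ × (∀ {x} → x ∈ˡ xs → Q ε x))
  list-bounded Q mono (α , α<γ) [] each = α , α<γ , λ ()
  list-bounded Q mono ne (x ∷ xs) each =
    let ε , ε<γ , Qx = each (here refl)
        ε′ , ε′<γ , Qxs = list-bounded Q mono ne xs (each ∘ there)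
    in ε ∨ ε′ , ∨-lub ε<γ ε′<γ , λ
      { (here refl) → mono (x≤x∨y ε ε′) Qx
      ; (there y∈xs) → mono (y≤x∨y ε ε′) (Qxs y∈xs) }

  <-rec : ∀ {p} (P : Ord → Set p) → (∀ x → (∀ {y} → y < x → P y) → P x) → ∀ x → P x
  <-rec P = All.wfRec <-wellFounded _ P

  IsLeast : ∀ {p} → (Ord → Set p) → Ord → Set (ℓ ⊔ p)
  IsLeast P x = P x × (∀ {y} → P y → x ≤ y)

  ∃-least : ∀ {p} {P : Ord → Set p} → ∃ P → ∃ (IsLeast P)
  ∃-least {P = P} (x , Px) = dne λ ¬least →
    <-rec (λ z → ¬ P z) (λ z ih Pz → ¬least (z , Pz , λ {y} Py → ≮⇒≥ λ y<z → ih y<z Py)) x Px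

  -- Classically two predicates with the same elements have the same least
  -- element, so a recursion through `least` needs no function extensionality.
  -- If P is empty the default value d is returned.
  least : ∀ {p} → Ord → (Ord → Set p) → Ord
  least d P with em {P = ∃ P}
  ... | yes ∃P = proj₁ (∃-least ∃P)
  ... | no  _  = d

  least-isLeast : ∀ {p} d {P : Ord → Set p} → ∃ P → IsLeast P (least d P)
  least-isLeast d {P} ∃P with em {P = ∃ P}
  ... | yes ∃P′ = proj₂ (∃-least ∃P′)
  ... | no  ¬∃P = contradiction ∃P ¬∃P

  least-cong : ∀ {p} d {P Q : Ord → Set p} → (∀ {x} → P x → Q x) → (∀ {x} → Q x → P x) →
               least d P ≡ least d Q
  least-cong d {P} {Q} P⇒Q Q⇒P with em {P = ∃ P} | em {P = ∃ Q}
  ... | yes ∃P | yes ∃Q = ≤-antisym (proj₂ lP (Q⇒P (proj₁ lQ))) (proj₂ lQ (P⇒Q (proj₁ lP)))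
    where
    lP = proj₂ (∃-least ∃P)
    lQ = proj₂ (∃-least ∃Q)
  ... | yes (x , Px) | no ¬∃Q = contradiction (x , P⇒Q Px) ¬∃Q
  ... | no ¬∃P | yes (x , Qx) = contradiction (x , Q⇒P Qx) ¬∃P
  ... | no _ | no _ = refl

  limit-isSup : ∀ {γ} (C : Subset) → IsLimit γ → (∀ {ε} → ε < γ → ∃[ x ] (x ∈ C × ε < x × x < γ)) →
                IsSup (Below γ ∩ C) γ
  limit-isSup {γ} C γ-lim cofinal = (λ (α<γ , _) → inj₁ α<γ) , λ β upper → ≮⇒≥ λ β<γ →
    let x , x∈C , β<x , x<γ = cofinal β<γ in <⇒≱ β<x (upper (x<γ , x∈C))

  isSup-cofinal : ∀ {γ} (C : Subset) → IsSup (Below γ ∩ C) γ → ∀ {ε} → ε < γ → ∃[ x ] (x ∈ C × ε < x × x < γ)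
  isSup-cofinal C (_ , lub) {ε} ε<γ = dne λ none →
    <⇒≱ ε<γ (lub ε λ (α<γ , α∈C) → ≮⇒≥ λ ε<α → none (_ , α∈C , ε<α , α<γ))

  -- Without such an ε the club would be cofinal in γ, and closedness would put γ into it.
  club-gap : ∀ {β γ C} → IsClub β C → IsLimit γ → γ < β → γ ∉ C →
             ∃[ ε ] (ε < γ × (∀ {x} → x ∈ C → ε < x → ¬ x < γ))
  club-gap {γ = γ} {C} club γ-lim γ<β γ∉C = dne λ no-gap → γ∉C
    (IsClub.closed club γ<β γ-lim (limit-isSup C γ-lim λ {ε} ε<γ → dne λ none →
      no-gap (ε , ε<γ , λ {x} x∈C ε<x x<γ → none (_ , x∈C , ε<x , x<γ))))

-- Regular uncountable cardinals: bounds, successors and an infinite ordinal.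

module Regular (em : ∀ {a} → ExcludedMiddle a) {ℓ : Level} (W : WellOrder ℓ)
  (μ : WellOrder.Carrier W) (μ-reg : Ordinals.IsRegularUncountable W μ) where

  open Order em W public

  ¬cofinal⇒bounded : ∀ {θ δ} (f : Ord → Ord) → (∀ {ε} → ε < θ → f ε < δ) → ¬ IsCofinalMap θ δ f →
                     ∃[ γ ] (γ < δ × (∀ {ε} → ε < θ → f ε < γ))
  ¬cofinal⇒bounded {θ} {δ} f f<δ ¬cof = dne λ unb → ¬cof (f<δ , λ {γ} γ<δ → dne λ none →
    unb (γ , γ<δ , λ {ε} ε<θ → ≰⇒> λ γ≤fε → none (_ , ε<θ , γ≤fε)))

  bounded : ∀ {θ} (f : Ord → Ord) → θ < μ → (∀ {ε} → ε < θ → f ε < μ) → ∃[ γ ] (γ < μ × (∀ {ε} → ε < θ → f ε < γ))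
  bounded f θ<μ f<μ = ¬cofinal⇒bounded f f<μ λ cof → proj₂ (proj₂ (proj₂ μ-reg)) θ<μ (_ , cof)

  -- A largest α below μ is impossible: if something lies below α, the constant map α on α is
  -- cofinal in μ, against regularity; otherwise α is the only ordinal below μ, and μ is countable.
  greater : ∀ {α} → α < μ → ∃[ β ] (α < β × β < μ)
  greater {α} α<μ = dne λ none →
    let ≤α : ∀ {x} → x < μ → x ≤ α
        ≤α x<μ = ≮⇒≥ λ α<x → none (_ , α<x , x<μ)
        least-α : ∀ {x} → ¬ x < α
        least-α x<α = proj₂ (proj₂ (proj₂ μ-reg)) α<μ
          ((λ _ → α) , (λ _ → α<μ) , λ {γ} γ<μ → _ , x<α , ≤α γ<μ)
        ≡α : ∀ {x} → x < μ → x ≡ α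
        ≡α x<μ = ≤-antisym (≤α x<μ) (≮⇒≥ least-α)
    in proj₁ (proj₂ μ-reg) ((λ _ → 0) , λ {x} {y} x<μ y<μ _ → trans (≡α x<μ) (sym (≡α y<μ)))

  next : Ord → Ord
  next α = least μ (α <_)

  next-isLeast : ∀ {α} → α < μ → IsLeast (α <_) (next α)
  next-isLeast α<μ = least-isLeast μ (_ , α<μ)

  next<μ : ∀ {α} → α < μ → next α < μ
  next<μ α<μ = let _ , α<β , β<μ = greater α<μ in ≤-<-trans (proj₂ (next-isLeast α<μ) α<β) β<μ

  inhabited : ∃[ α ] α < μ
  inhabited = dne λ none → proj₁ (proj₂ μ-reg) ((λ _ → 0) , λ {x} {y} x<μ → contradiction (_ , x<μ) none)

  0# : Ord
  0# = least μ (_< μ)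

  0#-isLeast : IsLeast (_< μ) 0#
  0#-isLeast = least-isLeast μ inhabited

  fin : ℕ → Ord
  fin zero    = 0#
  fin (suc n) = next (fin n)

  fin<μ : ∀ n → fin n < μ
  fin<μ zero    = proj₁ 0#-isLeast
  fin<μ (suc n) = next<μ (fin<μ n)

  fin-<-suc : ∀ n → fin n < fin (suc n)
  fin-<-suc n = proj₁ (next-isLeast (fin<μ n))

  fin-mono-< : ∀ {m n} → m ℕ.< n → fin m < fin n
  fin-mono-< {m} {suc n} (ℕ.s≤s m≤n) with ℕₚ.m≤n⇒m<n∨m≡n m≤n
  ... | inj₁ m<n  = <-trans (fin-mono-< m<n) (fin-<-suc n)
  ... | inj₂ refl = fin-<-suc n

  fin-injective : ∀ {m n} → fin m ≡ fin n → m ≡ n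
  fin-injective {m} {n} eq with ℕₚ.<-cmp m n
  ... | tri< m<n _ _ = contradiction (fin-mono-< m<n) (<-irrefl eq)
  ... | tri≈ _ m≡n _ = m≡n
  ... | tri> _ _ n<m = contradiction (fin-mono-< n<m) (<-irrefl (sym eq))

  ≤fin⇒≡fin : ∀ n {x} → x ≤ fin n → ∃[ m ] x ≡ fin m
  ≤fin⇒≡fin zero    x≤0 = 0 , ≤-antisym x≤0 (proj₂ 0#-isLeast (≤-<-trans x≤0 (fin<μ 0)))
  ≤fin⇒≡fin (suc n) {x} x≤fin with em {P = fin n < x}
  ... | yes fin<x = suc n , ≤-antisym x≤fin (proj₂ (next-isLeast (fin<μ n)) fin<x)
  ... | no  fin≮x = ≤fin⇒≡fin n (≮⇒≥ fin≮x)

  -- Otherwise every ordinal below μ is some `fin n`, and n codes μ injectively into ℕ.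
  ∃-infinite : ∃[ ω ] (ω < μ × (∀ n → fin n < ω))
  ∃-infinite = dne λ none →
    let code , code-spec = choose (_< μ) (λ x n → x ≡ fin n) 0 λ {x} x<μ →
          let n , ¬fin<x = ¬∀⇒∃¬ λ fin<x → none (x , x<μ , fin<x) in ≤fin⇒≡fin n (≮⇒≥ ¬fin<x)
    in proj₁ (proj₂ μ-reg) (code , λ {x} {y} x<μ y<μ eq →
         trans (code-spec x<μ) (trans (cong fin eq) (sym (code-spec y<μ))))

  -- Not necessarily the first infinite ordinal. It serves as an index set below μ, on which
  -- sequences over ℕ are spread out by `fin⁻¹`.
  ω : Ord
  ω = proj₁ ∃-infinite

  ω<μ : ω < μ
  ω<μ = proj₁ (proj₂ ∃-infinite)

  fin<ω : ∀ n → fin n < ω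
  fin<ω = proj₂ (proj₂ ∃-infinite)

  fin⁻¹ : Ord → ℕ
  fin⁻¹ = proj₁ (choose (λ x → ∃[ n ] x ≡ fin n) (λ x n → x ≡ fin n) 0 λ x → x)

  fin⁻¹-fin : ∀ n → fin⁻¹ (fin n) ≡ n
  fin⁻¹-fin n = sym (fin-injective
    (proj₂ (choose (λ x → ∃[ n ] x ≡ fin n) (λ x n → x ≡ fin n) 0 λ x → x) (n , refl)))

  ℕ-bounded : (t : ℕ → Ord) → (∀ n → t n < μ) → ∃[ γ ] (γ < μ × (∀ n → t n < γ))
  ℕ-bounded t t<μ =
    let γ , γ<μ , <γ = bounded (t ∘ fin⁻¹) ω<μ λ {ε} _ → t<μ (fin⁻¹ ε)
    in γ , γ<μ , λ n → subst (λ m → t m < γ) (fin⁻¹-fin n) (<γ (fin<ω n))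

  countable⇒cofinal : ∀ {β} → ω < β → ¬ IsUncountable β → ∃ (IsCofinalMap ω β)
  countable⇒cofinal {β} ω<β countable =
    let code , inj = dne countable
        decode , spec = choose (λ (_ : ℕ) → ω < β)
          (λ n x → x < β × (∀ {y} → y < β → code y ≡ n → y ≤ x)) ω (inverse code inj)
    in decode ∘ fin⁻¹ , (λ _ → proj₁ (spec ω<β)) , λ {γ} γ<β →
         fin (code γ) , fin<ω (code γ) , proj₂ (spec ω<β) γ<β (sym (fin⁻¹-fin (code γ)))
    where
    inverse : (code : Ord → ℕ) → (∀ {x y} → x < β → y < β → code x ≡ code y → x ≡ y) →
              ∀ {n} → ω < β → ∃ λ x → x < β × (∀ {y} → y < β → code y ≡ n → y ≤ x)
    inverse code inj {n} ω<β with em {P = ∃[ x ] (x < β × code x ≡ n)}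
    ... | yes (x , x<β , eq) = x , x<β , λ y<β eq′ → inj₂ (inj y<β x<β (trans eq′ (sym eq)))
    -- A number that codes nothing is sent to `ω`, merely to stay below β.
    ... | no none = ω , ω<β , λ y<β eq → contradiction (_ , y<β , eq) none

  -- Clubs of closure points, pressing down and enumerations.

  Preserves : (Ord → Ord) → Set ℓ
  Preserves g = ∀ {ε} → ε < μ → g ε < μ

  -- Every club of μ contains one of this form, so these are the only clubs
  -- that have to be considered.
  ClosurePoints : (Ord → Ord) → Subset
  ClosurePoints g γ = γ < μ × IsLimit γ × (∀ {ε} → ε < γ → g ε < γ)

  _∨ᶠ_ : (Ord → Ord) → (Ord → Ord) → Ord → Ord
  (g ∨ᶠ h) ε = g ε ∨ h ε

  ∨ᶠ-preserves : ∀ {g h} → Preserves g → Preserves h → Preserves (g ∨ᶠ h)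
  ∨ᶠ-preserves pg ph ε<μ = ∨-lub (pg ε<μ) (ph ε<μ)

  closurePoints-∨ˡ : ∀ g h {γ} → γ ∈ ClosurePoints (g ∨ᶠ h) → γ ∈ ClosurePoints g
  closurePoints-∨ˡ g h (γ<μ , lim , cl) =
    γ<μ , lim , λ ε<γ → ≤-<-trans (x≤x∨y (g _) (h _)) (cl ε<γ)

  closurePoints-∨ʳ : ∀ g h {γ} → γ ∈ ClosurePoints (g ∨ᶠ h) → γ ∈ ClosurePoints h
  closurePoints-∨ʳ g h (γ<μ , lim , cl) =
    γ<μ , lim , λ ε<γ → ≤-<-trans (y≤x∨y (g _) (h _)) (cl ε<γ)

  closurePoints-const : ∀ {ε γ} → γ ∈ ClosurePoints (λ _ → ε) → ε < γ
  closurePoints-const (_ , ((_ , α<γ) , _) , cl) = cl α<γ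

  -- Starting from α, jump repeatedly above all values of `g` on the segment reached so far. The
  -- least strict upper bound of this ℕ-sequence is a limit closed under `g`, and by `ℕ-bounded` it
  -- lies below μ.
  closurePoints-unbounded : ∀ {g} → Preserves g → ∀ {α} → α < μ →
                            ∃[ γ ] (γ ∈ ClosurePoints g × α < γ)
  closurePoints-unbounded {g} pg {α} α<μ = γ , (γ<μ , γ-limit , γ-closed) , s<γ 0
    where
    Above : Ord → Ord → Set ℓ
    Above x y = y < μ × x < y × (∀ {ε} → ε ≤ x → g ε < y)

    above : ∀ {x} → x < μ → ∃ (Above x)
    above {x} x<μ =
      let n<μ = next<μ x<μ
          x<n = proj₁ (next-isLeast x<μ)
          y , y<μ , g<y = bounded g n<μ λ ε<n → pg (<-trans ε<n n<μ)
      in y ∨ next x , ∨-lub y<μ n<μ , <-≤-trans x<n (y≤x∨y y (next x))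
       , λ ε≤x → <-≤-trans (g<y (≤-<-trans ε≤x x<n)) (x≤x∨y y (next x))

    h = proj₁ (choose (_< μ) Above μ above)
    h-above : ∀ {x} → x < μ → Above x (h x)
    h-above = proj₂ (choose (_< μ) Above μ above)

    s : ℕ → Ord
    s zero    = α
    s (suc n) = h (s n)

    s<μ : ∀ n → s n < μ
    s<μ zero    = α<μ
    s<μ (suc n) = proj₁ (h-above (s<μ n))

    UpperBound : Ord → Set ℓ
    UpperBound y = ∀ n → s n < y

    bound = ℕ-bounded s s<μ
    γ = least μ UpperBound
    γ-isLeast : IsLeast UpperBound γ
    γ-isLeast = least-isLeast μ (proj₁ bound , proj₂ (proj₂ bound))
    s<γ : ∀ n → s n < γ
    s<γ = proj₁ γ-isLeast
    γ<μ : γ < μ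
    γ<μ = ≤-<-trans (proj₂ γ-isLeast (proj₂ (proj₂ bound))) (proj₁ (proj₂ bound))

    below-s : ∀ {ε} → ε < γ → ∃[ n ] ε ≤ s n
    below-s ε<γ =
      let n , s≮ε = ¬∀⇒∃¬ λ s<ε → <⇒≱ ε<γ (proj₂ γ-isLeast s<ε) in n , ≮⇒≥ s≮ε

    γ-limit : IsLimit γ
    γ-limit = (α , s<γ 0) , λ ε<γ → let n , ε≤s = below-s ε<γ in
      s (suc n) , ≤-<-trans ε≤s (proj₁ (proj₂ (h-above (s<μ n)))) , s<γ (suc n)

    γ-closed : ∀ {ε} → ε < γ → g ε < γ
    γ-closed ε<γ = let n , ε≤s = below-s ε<γ in
      <-trans (proj₂ (proj₂ (h-above (s<μ n))) ε≤s) (s<γ (suc n))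

  closurePoints-club : ∀ {g} → Preserves g → IsClub μ (ClosurePoints g)
  closurePoints-club {g} pg = record
    { subset    = proj₁
    ; unbounded = λ γ<μ → let x , x∈D , γ<x = closurePoints-unbounded pg γ<μ in x , x∈D , inj₁ γ<x
    ; closed    = λ α<μ α-lim sup → α<μ , α-lim , λ ε<α →
        let x , (_ , _ , closed) , ε<x , x<α = isSup-cofinal (ClosurePoints g) sup ε<α in <-trans (closed ε<x) x<α
    }

  -- Let `g ε` be a point of `E` beyond ε. A limit closed under `g` is a limit of points of `E`.
  club-contains-closurePoints : ∀ {E} → IsClub μ E →
    ∃ λ g → Preserves g × (∀ {γ} → γ ∈ ClosurePoints g → γ ∈ E)
  club-contains-closurePoints {E} club =
    let g , spec = choose (_< μ) (λ ε x → x ∈ E × ε < x) μ λ ε<μ →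
          let _ , ε<β , β<μ = greater ε<μ ; x , x∈E , β≤x = IsClub.unbounded club β<μ
          in x , x∈E , <-≤-trans ε<β β≤x
    in g , (λ ε<μ → IsClub.subset club (proj₁ (spec ε<μ)))
     , λ (γ<μ , γ-lim , closed) → IsClub.closed club γ<μ γ-lim (limit-isSup E γ-lim λ ε<γ →
         let gε∈E , ε<gε = spec (<-trans ε<γ γ<μ) in _ , gε∈E , ε<gε , closed ε<γ)

  -- An elementary variant of Fodor's lemma for a relation, yielding unboundedly many γ rather than
  -- stationarily many. If no single ε serves unboundedly many γ, let `g ε` bound the γ that ε
  -- serves; a closure point γ lies above `g ε` for all ε below it.
  pressing-down : ∀ {p} (P : Ord → Ord → Set p) →
      (∃[ ε ] (ε < μ × (∀ {α} → α < μ → ∃[ γ ] (α ≤ γ × γ < μ × P ε γ))))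
    ⊎ (∃ λ g → Preserves g × (∀ {γ ε} → γ ∈ ClosurePoints g → ε < γ → ¬ P ε γ))
  pressing-down P with em {P = ∃[ ε ] (ε < μ × (∀ {α} → α < μ → ∃[ γ ] (α ≤ γ × γ < μ × P ε γ)))}
  ... | yes fixed = inj₁ fixed
  ... | no ¬fixed =
    let g , spec = choose (_< μ) (λ ε α → α < μ × (∀ {γ} → α ≤ γ → γ < μ → ¬ P ε γ)) μ
          λ {ε} ε<μ → dne λ none → ¬fixed (ε , ε<μ , λ {α} α<μ → dne λ none′ →
            none (α , α<μ , λ {γ} α≤γ γ<μ Pεγ → none′ (_ , α≤γ , γ<μ , Pεγ)))
    in inj₂ (g , proj₁ ∘ spec , λ (γ<μ , _ , closed) ε<γ →
         proj₂ (spec (<-trans ε<γ γ<μ)) (inj₁ (closed ε<γ)) γ<μ)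

  -- Regularity bounds the values chosen so far, so the recursion reaches every ζ below μ.
  enumerate : ∀ {T : Subset} → T ⊆ Below μ → (∀ {α} → α < μ → ∃[ y ] (y ∈ T × α < y)) →
              ∃ λ (e : Ord → Ord) → ∀ {ζ} → ζ < μ → e ζ ∈ T × (∀ {ζ′} → ζ′ < ζ → e ζ′ < e ζ)
  enumerate {T} T⊆μ unbounded = e , λ {ζ} → e-spec ζ
    where
    Candidate : ∀ ζ → WfRec _<_ (λ _ → Ord) ζ → Ord → Set ℓ
    Candidate ζ e y = y ∈ T × (∀ {ζ′} (ζ′<ζ : ζ′ < ζ) → e ζ′<ζ < y)

    F : ∀ ζ → WfRec _<_ (λ _ → Ord) ζ → Ord
    F ζ e = least μ (Candidate ζ e)

    F-cong : ∀ ζ {e e′ : WfRec _<_ (λ _ → Ord) ζ} → (∀ {y} (y<ζ : y < ζ) → e y<ζ ≡ e′ y<ζ) →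
             F ζ e ≡ F ζ e′
    F-cong ζ e≡e′ = least-cong μ
      (λ (y∈T , <y) → y∈T , λ ζ′<ζ → subst (_< _) (e≡e′ ζ′<ζ) (<y ζ′<ζ))
      (λ (y∈T , <y) → y∈T , λ ζ′<ζ → subst (_< _) (sym (e≡e′ ζ′<ζ)) (<y ζ′<ζ))

    e : Ord → Ord
    e = <-rec (λ _ → Ord) F

    e-spec : ∀ ζ → ζ < μ → Candidate ζ (λ {y} _ → e y) (e ζ)
    e-spec = <-rec _ λ ζ ih ζ<μ →
      let γ , γ<μ , e<γ = bounded e ζ<μ λ ζ′<ζ → T⊆μ (proj₁ (ih ζ′<ζ (<-trans ζ′<ζ ζ<μ)))
          y , y∈T , γ<y = unbounded γ<μ
      in subst (Candidate ζ (λ {y} _ → e y))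
           (sym (FixPoint.unfold-wfRec <-wellFounded (λ _ → Ord) F F-cong))
           (proj₁ (least-isLeast μ {Candidate ζ (λ {y} _ → e y)} (y , y∈T , λ ζ′<ζ → <-trans (e<γ ζ′<ζ) γ<y)))

  increasing⇒equinumerous : ∀ {f : Ord → Ord} → (∀ {ζ ζ′} → ζ < ζ′ → ζ′ < μ → f ζ < f ζ′) →
                            Equinumerous (Below μ) (λ x → ∃[ ζ ] (ζ < μ × f ζ ≡ x))
  increasing⇒equinumerous {f} f-mono = f , (λ ζ<μ → _ , ζ<μ , refl) , inj , λ x → x
    where
    inj : ∀ {x y} → x < μ → y < μ → f x ≡ f y → x ≡ y
    inj {x} {y} x<μ y<μ fx≡fy with compare x y
    ... | tri< x<y _ _ = contradiction (f-mono x<y y<μ) (<-irrefl fx≡fy)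
    ... | tri≈ _ x≡y _ = x≡y
    ... | tri> _ _ y<x = contradiction (f-mono y<x x<μ) (<-irrefl (sym fx≡fy))

  Captures : Subset → (Ord → Ord) → Ord → Set ℓ
  Captures A g α = ∀ {γ} → γ ∈ ClosurePoints g → γ < α → γ ∈ A

  -- The club D is presented as `ClosurePoints g`; by `club-contains-closurePoints` this is no
  -- restriction.
  Trivial : (Ord → Subset) → Set ℓ
  Trivial C = ∃ λ g → Preserves g × (∀ {α} → α < μ → ∃[ β ] (α ≤ β × β < μ × Captures (C β) g α))

-- Walks along a club sequence and their lengths.

module Walks (em : ∀ {a} → ExcludedMiddle a) {ℓ : Level} (W : WellOrder ℓ)
  (μ : WellOrder.Carrier W) (μ-reg : Ordinals.IsRegularUncountable W μ)
  (C : WellOrder.Carrier W → Ordinals.Subset W)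
  (C-club : ∀ {β} → WellOrder._<_ W β μ → Ordinals.IsClub W β (C β)) where

  open Regular em W μ μ-reg

  step : Ord → Ord → Ord
  step α β = least μ (λ x → x ∈ C β × α ≤ x)

  step-isLeast : ∀ {α β} → α < β → β < μ → IsLeast (λ x → x ∈ C β × α ≤ x) (step α β)
  step-isLeast α<β β<μ = least-isLeast μ (IsClub.unbounded (C-club β<μ) α<β)

  step< : ∀ {α β} → α < β → β < μ → step α β < β
  step< α<β β<μ = IsClub.subset (C-club β<μ) (proj₁ (proj₁ (step-isLeast α<β β<μ)))

  -- The number of steps of the walk from β down to α along C
  -- (and 0, when there is no such walk).
  ρ-body : ∀ α β → WfRec _<_ (λ _ → ℕ) β → ℕ
  ρ-body α β rec with em {P = α < β × step α β < β}
  ... | yes (_ , step<β) = suc (rec step<β)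
  ... | no  _            = 0

  ρ-cong : ∀ α β {r r′ : WfRec _<_ (λ _ → ℕ) β} → (∀ {y} (y<β : y < β) → r y<β ≡ r′ y<β) →
           ρ-body α β r ≡ ρ-body α β r′
  ρ-cong α β r≡r′ with em {P = α < β × step α β < β}
  ... | yes (_ , step<β) = cong suc (r≡r′ step<β)
  ... | no  _            = refl

  ρ : Ord → Ord → ℕ
  ρ α = <-rec (λ _ → ℕ) (ρ-body α)

  ρ-step : ∀ {α β} → α < β → β < μ → ρ α β ≡ suc (ρ α (step α β))
  ρ-step {α} {β} α<β β<μ = trans
    (FixPoint.unfold-wfRec <-wellFounded (λ _ → ℕ) (ρ-body α) (ρ-cong α)) body
    where
    body : ρ-body α β (λ {y} _ → ρ α y) ≡ suc (ρ α (step α β))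
    body with em {P = α < β × step α β < β}
    ... | yes _ = refl
    ... | no ¬p = contradiction (α<β , step< α<β β<μ) ¬p

  ρ≡0⇒≡ : ∀ {α β} → α ≤ β → β < μ → ρ α β ≡ 0 → α ≡ β
  ρ≡0⇒≡ (inj₂ α≡β) _   _    = α≡β
  ρ≡0⇒≡ (inj₁ α<β) β<μ ρ≡0 with trans (sym ρ≡0) (ρ-step α<β β<μ)
  ... | ()

  ρ-diag : ∀ α → ρ α α ≡ 0
  ρ-diag α = trans (FixPoint.unfold-wfRec <-wellFounded (λ _ → ℕ) (ρ-body α) (ρ-cong α)) body
    where
    body : ρ-body α α (λ {y} _ → ρ α y) ≡ 0
    body with em {P = α < α × step α α < α}
    ... | yes (α<α , _) = contradiction α<α (<-irrefl refl)
    ... | no _          = refl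

  -- Walks to points slightly below a limit γ follow the walk to γ until its
  -- last step, which starts at an ordinal ξ with γ ∈ C ξ.
  ρ-below-limit : ∀ {γ} → IsLimit γ → ∀ β → γ < β → β < μ →
    ∃[ ε ] (ε < γ × (∃[ ξ ] (γ < ξ × ξ < μ ×
      (∀ {δ} → ε < δ → δ < γ → ρ γ β ℕ.≤ ρ δ β × (ρ δ β ≡ ρ γ β → δ ∈ C ξ)))))
  ρ-below-limit {γ} γ-lim = <-rec _ λ β ih γ<β β<μ → case β ih γ<β β<μ
    where
    Tail : Ord → Set ℓ
    Tail β = γ < β → β < μ →
      ∃[ ε ] (ε < γ × (∃[ ξ ] (γ < ξ × ξ < μ ×
        (∀ {δ} → ε < δ → δ < γ → ρ γ β ℕ.≤ ρ δ β × (ρ δ β ≡ ρ γ β → δ ∈ C ξ)))))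

    case : ∀ β → (∀ {y} → y < β → Tail y) → Tail β
    case β ih γ<β β<μ with em {P = γ ∈ C β}
    -- The walk to γ takes a single step, from ξ = β. If the walk to δ has length 1 as well, its
    -- only step lands on δ, so δ is in `C β`. Any ε below γ will do.
    ... | yes γ∈C = proj₁ (proj₁ γ-lim) , proj₂ (proj₁ γ-lim) , β , γ<β , β<μ , tail
      where
      step≡γ : step γ β ≡ γ
      step≡γ = ≤-antisym (proj₂ (step-isLeast γ<β β<μ) (γ∈C , ≤-refl))
                         (proj₂ (proj₁ (step-isLeast γ<β β<μ)))
      ργ≡1 : ρ γ β ≡ 1
      ργ≡1 = trans (ρ-step γ<β β<μ) (cong suc (trans (cong (ρ γ) step≡γ) (ρ-diag γ)))
      tail : ∀ {δ} → _ → δ < γ → ρ γ β ℕ.≤ ρ δ β × (ρ δ β ≡ ρ γ β → δ ∈ C β)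
      tail {δ} _ δ<γ = ≤ρ , ∈C
        where
        δ<β = <-trans δ<γ γ<β
        stepδ = step-isLeast δ<β β<μ
        ρδ = ρ-step δ<β β<μ
        ≤ρ : ρ γ β ℕ.≤ ρ δ β
        ≤ρ rewrite ργ≡1 | ρδ = ℕ.s≤s ℕ.z≤n
        ∈C : ρ δ β ≡ ρ γ β → δ ∈ C β
        ∈C eq = subst (_∈ C β) (sym δ≡step) (proj₁ (proj₁ stepδ))
          where
          δ≡step : δ ≡ step δ β
          δ≡step = ρ≡0⇒≡ (proj₂ (proj₁ stepδ)) (<-trans (step< δ<β β<μ) β<μ)
            (ℕₚ.suc-injective (trans (sym ρδ) (trans eq ργ≡1)))
    -- Above the gap `C β` has no point below γ, so the walks to δ and to γ share their first step,
    -- and induction applies at `β′`.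
    ... | no γ∉C = ε₀ ∨ ε₁ , ∨-lub ε₀<γ ε₁<γ , ξ , γ<ξ , ξ<μ , tail
      where
      stepγ = step-isLeast γ<β β<μ
      β′ = step γ β
      γ<β′ : γ < β′
      γ<β′ with proj₂ (proj₁ stepγ)
      ... | inj₁ γ<β′ = γ<β′
      ... | inj₂ γ≡β′ = contradiction (subst (_∈ C β) (sym γ≡β′) (proj₁ (proj₁ stepγ))) γ∉C
      β′<β = step< γ<β β<μ
      gap = club-gap (C-club β<μ) γ-lim γ<β γ∉C
      ε₀ = proj₁ gap
      ε₀<γ = proj₁ (proj₂ gap)
      rest = ih β′<β γ<β′ (<-trans β′<β β<μ)
      ε₁ = proj₁ rest
      ε₁<γ = proj₁ (proj₂ rest)
      ξ = proj₁ (proj₂ (proj₂ rest))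
      γ<ξ = proj₁ (proj₂ (proj₂ (proj₂ rest)))
      ξ<μ = proj₁ (proj₂ (proj₂ (proj₂ (proj₂ rest))))
      tail : ∀ {δ} → ε₀ ∨ ε₁ < δ → δ < γ → ρ γ β ℕ.≤ ρ δ β × (ρ δ β ≡ ρ γ β → δ ∈ C ξ)
      tail {δ} ε<δ δ<γ = ≤ρ , ∈C
        where
        δ<β = <-trans δ<γ γ<β
        stepδ = step-isLeast δ<β β<μ
        stepδ≥γ : γ ≤ step δ β
        stepδ≥γ = ≮⇒≥ (proj₂ (proj₂ gap) (proj₁ (proj₁ stepδ))
          (<-≤-trans (≤-<-trans (x≤x∨y ε₀ ε₁) ε<δ) (proj₂ (proj₁ stepδ))))
        stepδ≡β′ : step δ β ≡ β′
        stepδ≡β′ = ≤-antisym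
          (proj₂ stepδ (proj₁ (proj₁ stepγ) , inj₁ (<-trans δ<γ γ<β′)))
          (proj₂ stepγ (proj₁ (proj₁ stepδ) , stepδ≥γ))
        ργ : ρ γ β ≡ suc (ρ γ β′)
        ργ = ρ-step γ<β β<μ
        ρδ : ρ δ β ≡ suc (ρ δ β′)
        ρδ = trans (ρ-step δ<β β<μ) (cong (suc ∘ ρ δ) stepδ≡β′)
        below-β′ = proj₂ (proj₂ (proj₂ (proj₂ (proj₂ rest)))) (≤-<-trans (y≤x∨y ε₀ ε₁) ε<δ) δ<γ
        ≤ρ : ρ γ β ℕ.≤ ρ δ β
        ≤ρ rewrite ργ | ρδ = ℕ.s≤s (proj₁ below-β′)
        ∈C : ρ δ β ≡ ρ γ β → δ ∈ C ξ
        ∈C eq = proj₂ below-β′ (ℕₚ.suc-injective (trans (sym ρδ) (trans eq ργ)))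

  -- A list rather than a finite predicate, so that its length is available for induction.
  Near : ℕ → (Ord → Ord) → Ord → List Ord → Set ℓ
  Near n g α F = (∀ {β} → β ∈ˡ F → α ≤ β × β < μ)
    × (∀ {γ} → γ ∈ ClosurePoints g → γ < α → ∃[ β ] (β ∈ˡ F × ρ γ β ℕ.< n))

  -- Induction on n by pressing down on the ε of `ρ-below-limit`. If one ε serves unboundedly many
  -- γ, every δ of the club with ε < δ < γ has `ρ δ β` both at most and at least n, so ξ captures
  -- it. Otherwise, on a smaller club, length exactly n never occurs and the bound drops.
  near-point⇒trivial : ∀ n {g} → Preserves g →
    (∀ {α} → α < μ → ∃[ β ] (α ≤ β × β < μ × (∀ {γ} → γ ∈ ClosurePoints g → γ < α → ρ γ β ℕ.< n))) →
    Trivial C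
  near-point⇒trivial zero {g} pg near =
    let γ , γ∈D , _ = closurePoints-unbounded pg (proj₂ inhabited)
        α , γ<α , α<μ = greater (proj₁ γ∈D)
        _ , _ , _ , ρ<0 = near α<μ
    in contradiction (ρ<0 γ∈D γ<α) λ ()
  near-point⇒trivial (suc n) {g} pg near = conclude (pressing-down P)
    where
    P : Ord → Ord → Set ℓ
    P ε γ = ∃[ β ] (∃[ α ] ((∀ {δ} → δ ∈ ClosurePoints g → δ < α → ρ δ β ℕ.< suc n) × γ < α ×
      (∃[ ξ ] (γ < ξ × ξ < μ ×
      (∀ {δ} → ε < δ → δ < γ → n ℕ.≤ ρ δ β × (ρ δ β ≡ n → δ ∈ C ξ))))))

    conclude : _ → Trivial C
    conclude (inj₁ (ε , ε<μ , stationary)) =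
      g ∨ᶠ (λ _ → ε) , ∨ᶠ-preserves pg (λ _ → ε<μ) , λ {α₀} α₀<μ →
      let γ , α₀≤γ , γ<μ , β , α , ρ<sn , γ<α , ξ , γ<ξ , ξ<μ , tail = stationary α₀<μ
      in ξ , inj₁ (≤-<-trans α₀≤γ γ<ξ) , ξ<μ , λ {δ} δ∈D δ<α₀ →
         let δ<γ = <-≤-trans δ<α₀ α₀≤γ
             ≥n , ∈C = tail (closurePoints-const (closurePoints-∨ʳ g (λ _ → ε) δ∈D)) δ<γ
             ≤n = ℕₚ.≤-pred (ρ<sn (closurePoints-∨ˡ g (λ _ → ε) δ∈D) (<-trans δ<γ γ<α))
         in ∈C (ℕₚ.≤-antisym ≤n ≥n)
    conclude (inj₂ (h , ph , ¬P)) = near-point⇒trivial n (∨ᶠ-preserves pg ph) λ α<μ →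
      let β , α≤β , β<μ , ρ<sn = near α<μ
      in β , α≤β , β<μ , λ {γ} γ∈D γ<α → ℕₚ.≤∧≢⇒<
           (ℕₚ.≤-pred (ρ<sn (closurePoints-∨ˡ g h γ∈D) γ<α)) λ ρ≡n →
         let ε , ε<γ , ξ , γ<ξ , ξ<μ , tail =
               ρ-below-limit (proj₁ (proj₂ γ∈D)) β (<-≤-trans γ<α α≤β) β<μ
         in ¬P (closurePoints-∨ʳ g h γ∈D) ε<γ (β , _ , ρ<sn , γ<α , ξ , γ<ξ , ξ<μ , λ {δ} ε<δ δ<γ →
              subst (λ m → m ℕ.≤ ρ δ β × (ρ δ β ≡ m → δ ∈ C ξ)) ρ≡n (tail ε<δ δ<γ))

  near-list⇒trivial : ∀ k n {g} → Preserves g →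
    (∀ {α} → α < μ → ∃[ F ] (length F ≡ k × Near n g α F)) → Trivial C
  near-list⇒trivial zero n {g} pg near =
    let γ , γ∈D , _ = closurePoints-unbounded pg (proj₂ inhabited)
        α , γ<α , α<μ = greater (proj₁ γ∈D)
    in ⊥-elim (empty (near α<μ) γ∈D γ<α)
    where
    empty : ∀ {α γ} → ∃[ F ] (length F ≡ 0 × Near n g α F) → γ ∈ ClosurePoints g → γ < α → ⊥
    empty ([] , _ , _ , cover) γ∈D γ<α with cover γ∈D γ<α
    ... | _ , () , _
  near-list⇒trivial (suc k) n {g} pg near = conclude (pressing-down P)
    where
    P : Ord → Ord → Set ℓ
    P ε γ = ∃[ β ] (∃[ F ] (∃[ α ] (length F ≡ k × Near n g α (β ∷ F) × γ < α
      × (∀ {δ} → ε < δ → δ < γ → n ℕ.≤ ρ δ β))))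

    conclude : _ → Trivial C
    conclude (inj₁ (ε , ε<μ , stationary)) =
      near-list⇒trivial k n (∨ᶠ-preserves pg (λ _ → ε<μ)) drop-head
      where
      g′ = g ∨ᶠ (λ _ → ε)
      drop-head : ∀ {α} → α < μ → ∃[ F ] (length F ≡ k × Near n g′ α F)
      drop-head {α₀} α₀<μ with stationary α₀<μ
      ... | γ , α₀≤γ , γ<μ , β , F , α , len , (F≥α , cover) , γ<α , far =
        F , len , (λ β∈F → let α≤β , β<μ = F≥α (there β∈F) in
          inj₁ (≤-<-trans α₀≤γ (<-≤-trans γ<α α≤β)) , β<μ) , cover′
        where
        cover′ : ∀ {δ} → δ ∈ ClosurePoints g′ → δ < α₀ → ∃[ β ] (β ∈ˡ F × ρ δ β ℕ.< n)
        cover′ δ∈D δ<α₀ with cover (closurePoints-∨ˡ g (λ _ → ε) δ∈D) (<-trans (<-≤-trans δ<α₀ α₀≤γ) γ<α)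
        ... | β′ , there β′∈F , ρ<n = β′ , β′∈F , ρ<n
        ... | _ , here refl , ρ<n = contradiction
          (far (closurePoints-const (closurePoints-∨ʳ g (λ _ → ε) δ∈D)) (<-≤-trans δ<α₀ α₀≤γ))
          (ℕₚ.<⇒≱ ρ<n)
    conclude (inj₂ (h , ph , ¬P)) = near-point⇒trivial n (∨ᶠ-preserves pg ph) λ α<μ → head (near α<μ)
      where
      head : ∀ {α} → ∃[ F ] (length F ≡ suc k × Near n g α F) →
        ∃[ β ] (α ≤ β × β < μ × (∀ {γ} → γ ∈ ClosurePoints (g ∨ᶠ h) → γ < α → ρ γ β ℕ.< n))
      head (β ∷ F , len , F-near@(F≥α , _)) =
        let α≤β , β<μ = F≥α (here refl)
        in β , α≤β , β<μ , λ γ∈D γ<α → ℕₚ.≰⇒> λ n≤ρ →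
           let ε , ε<γ , _ , _ , _ , tail =
                 ρ-below-limit (proj₁ (proj₂ γ∈D)) β (<-≤-trans γ<α α≤β) β<μ
           in ¬P (closurePoints-∨ʳ g h γ∈D) ε<γ (β , F , _ , ℕₚ.suc-injective len , F-near , γ<α ,
                λ ε<δ δ<γ → ℕₚ.≤-trans n≤ρ (proj₁ (tail ε<δ δ<γ)))

  -- The length must be made independent of α. If each length k fails at some α, these countably
  -- many α are bounded by some σ below μ; but a list near σ has some length k and also serves the
  -- smaller α where k fails.
  near⇒trivial : ∀ n {g} → Preserves g → (∀ {α} → α < μ → ∃ (Near n g α)) → Trivial C
  near⇒trivial n {g} pg near = dne λ ¬trivial →
    let Fails : ℕ → Ord → Set ℓ
        Fails k α = α < μ × ¬ (∃[ F ] (length F ≡ k × Near n g α F))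
        fails : ∀ k → ∃ (Fails k)
        fails k = dne λ none → ¬trivial (near-list⇒trivial k n pg λ {α} α<μ →
          dne λ no-F → none (α , α<μ , no-F))
        σ , σ<μ , <σ = ℕ-bounded (proj₁ ∘ fails) (proj₁ ∘ proj₂ ∘ fails)
        F , F≥σ , cover = near σ<μ
        k = length F
    in proj₂ (proj₂ (fails k)) (F , refl
         , (λ β∈F → let σ≤β , β<μ = F≥σ β∈F in inj₁ (<-≤-trans (<σ k) σ≤β) , β<μ)
         , λ γ∈D γ<α → cover γ∈D (<-trans γ<α (<σ k)))

-- The colouring by walk lengths on families of finite sets.

module Colouring (em : ∀ {a} → ExcludedMiddle a) {ℓ : Level} (W : WellOrder ℓ)
  (μ : WellOrder.Carrier W) (μ-reg : Ordinals.IsRegularUncountable W μ)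
  (C : WellOrder.Carrier W → Ordinals.Subset W)
  (C-club : ∀ {β} → WellOrder._<_ W β μ → Ordinals.IsClub W β (C β)) where

  open Regular em W μ μ-reg
  open Walks em W μ μ-reg C C-club

  -- The sum only symmetrises: walks go downwards, so at least one summand is 0.
  colour : Ord → Ord → ℕ
  colour i j = ρ i j + ρ j i

  colour-sym : ∀ i j → colour i j ≡ colour j i
  colour-sym i j = ℕₚ.+-comm (ρ i j) (ρ j i)

  -- Pressing down on `P`: if one ε serves unboundedly many γ, the indices are thinned out to the
  -- required set. Otherwise there is a club such that for every α some `w ξ` above α has, for each
  -- γ of the club below α, a point fewer than n steps away; then `near⇒trivial` applies.
  colour-unbounded : ¬ Trivial C → ∀ (w : Ord → Subset) →
    (∀ {α} → α < μ → w α ⊆ Below μ × Finite (w α)) → PairwiseDisjoint (Below μ) w → ∀ n →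
    ∃ λ (X : Subset) → (X ∈ ([ Below μ ]^ μ)
      × (∀ {α β} → α ∈ X → β ∈ X → α < β → ∀ {i j} → i ∈ w α → j ∈ w β → n ℕ.≤ colour i j))
  colour-unbounded ¬trivial w w-fin disjoint n = conclude (pressing-down P)
    where
    -- `Finite` supplies a list that may contain foreign points; filtering removes them, so that
    -- bounds known on `w α` hold along the list.
    elements : ∀ {α} → α < μ → List Ord
    elements {α} α<μ = filter (λ x → em {P = x ∈ w α}) (proj₁ (proj₂ (w-fin α<μ)))

    ∈-elements⁺ : ∀ {α x} (α<μ : α < μ) → x ∈ w α → x ∈ˡ elements α<μ
    ∈-elements⁺ {α} α<μ x∈w =
      ∈-filter⁺ (λ x → em {P = x ∈ w α}) (proj₂ (proj₂ (w-fin α<μ)) x∈w) x∈w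

    ∈-elements⁻ : ∀ {α x} (α<μ : α < μ) → x ∈ˡ elements α<μ → x ∈ w α
    ∈-elements⁻ {α} α<μ x∈xs =
      proj₂ (∈-filter⁻ (λ x → em {P = x ∈ w α}) {xs = proj₁ (proj₂ (w-fin α<μ))} x∈xs)

    owner-of : ∀ x → ∃[ ξ ] (ξ < μ × (∀ {ξ′} → ξ′ < μ → x ∈ w ξ′ → ξ′ ≡ ξ))
    owner-of x with em {P = ∃[ ξ ] (ξ < μ × x ∈ w ξ)}
    ... | yes (ξ , ξ<μ , x∈w) = ξ , ξ<μ , λ ξ′<μ x∈w′ → dne λ ξ′≢ξ → disjoint ξ′<μ ξ<μ ξ′≢ξ x∈w′ x∈w
    ... | no none = 0# , proj₁ 0#-isLeast , λ ξ′<μ x∈w′ → contradiction (_ , ξ′<μ , x∈w′) none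

    -- By disjointness each point up to γ has at most one owner, so regularity bounds all their
    -- owners; the set of any later index lies wholly above γ.
    beyond : ∀ {γ} → γ < μ → ∃[ ξ ] (ξ < μ × γ ≤ ξ × (∀ {j} → j ∈ w ξ → γ < j))
    beyond {γ} γ<μ =
      let _ , γ<γ′ , γ′<μ = greater γ<μ
          b , b<μ , <b = bounded (proj₁ ∘ owner-of) γ′<μ λ {x} _ → proj₁ (proj₂ (owner-of x))
          ξ<μ = ∨-lub b<μ γ<μ
      in b ∨ γ , ξ<μ , y≤x∨y b γ , λ {j} j∈w → ≰⇒> λ j≤γ →
         <-irrefl (sym (proj₂ (proj₂ (owner-of j)) ξ<μ j∈w))
           (<-≤-trans (<b (≤-<-trans j≤γ γ<γ′)) (x≤x∨y b γ))

    P : Ord → Ord → Set ℓ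
    P ε γ = ∃[ ξ ] (ξ < μ × γ ≤ ξ ×
      (∀ {j} → j ∈ w ξ → γ < j × (∀ {δ} → ε < δ → δ < γ → n ℕ.≤ ρ δ j)))

    Conclusion : Set (Level.suc ℓ)
    Conclusion = ∃ λ (X : Subset) → (X ∈ ([ Below μ ]^ μ)
      × (∀ {α β} → α ∈ X → β ∈ X → α < β → ∀ {i j} → i ∈ w α → j ∈ w β → n ℕ.≤ colour i j))

    module Spread {ε} (ε<μ : ε < μ)
      (stationary : ∀ {α} → α < μ → ∃[ γ ] (α ≤ γ × γ < μ × P ε γ)) where

      Next : Ord → Ord × Ord → Set ℓ
      Next δ (ξ , b) = ξ < μ × δ ≤ ξ × ξ < b × b < μ ×
        (∀ {j} → j ∈ w ξ → δ < j × j < b × (∀ {i} → ε < i → i < δ → n ℕ.≤ ρ i j))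

      next-exists : ∀ {δ} → δ < μ → ∃ (Next δ)
      next-exists δ<μ =
        let γ , δ≤γ , γ<μ , ξ , ξ<μ , γ≤ξ , w-far = stationary δ<μ
            b₁ , ξ<b₁ , b₁<μ = greater ξ<μ
            b₂ , b₂<μ , <b₂ = list-bounded (λ b x → x < b) (λ b≤b′ x<b → <-≤-trans x<b b≤b′)
              inhabited (elements ξ<μ) λ x∈xs →
              let _ , x<b , b<μ = greater (proj₁ (w-fin ξ<μ) (∈-elements⁻ ξ<μ x∈xs)) in _ , b<μ , x<b
        in (ξ , b₁ ∨ b₂) , ξ<μ , ≤-trans δ≤γ γ≤ξ , <-≤-trans ξ<b₁ (x≤x∨y b₁ b₂) , ∨-lub b₁<μ b₂<μ
         , λ j∈w → let γ<j , j-far = w-far j∈w in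
             ≤-<-trans δ≤γ γ<j , <-≤-trans (<b₂ (∈-elements⁺ ξ<μ j∈w)) (y≤x∨y b₁ b₂)
           , λ ε<i i<δ → j-far ε<i (<-≤-trans i<δ δ≤γ)

      module _ (index bound : Ord → Ord) (next-spec : ∀ {δ} → δ < μ → Next δ (index δ , bound δ))
        (e : Ord → Ord) (e-spec : ∀ {ζ} → ζ < μ →
          e ζ ∈ ClosurePoints (bound ∨ᶠ (λ _ → ε)) × (∀ {ζ′} → ζ′ < ζ → e ζ′ < e ζ)) where

        e<μ : ∀ {ζ} → ζ < μ → e ζ < μ
        e<μ ζ<μ = proj₁ (proj₁ (e-spec ζ<μ))

        bound<e : ∀ {ζ ζ′} → ζ < ζ′ → ζ′ < μ → bound (e ζ) < e ζ′
        bound<e ζ<ζ′ ζ′<μ = proj₂ (proj₂ (closurePoints-∨ˡ bound (λ _ → ε) (proj₁ (e-spec ζ′<μ))))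
          (proj₂ (e-spec ζ′<μ) ζ<ζ′)

        index-mono : ∀ {ζ ζ′} → ζ < ζ′ → ζ′ < μ → index (e ζ) < index (e ζ′)
        index-mono ζ<ζ′ ζ′<μ =
          let _ , _ , x<b , _ = next-spec (e<μ (<-trans ζ<ζ′ ζ′<μ))
              _ , e≤x , _ = next-spec (e<μ ζ′<μ)
          in <-≤-trans (<-trans x<b (bound<e ζ<ζ′ ζ′<μ)) e≤x

        X : Subset
        X α = ∃[ ζ ] (ζ < μ × index (e ζ) ≡ α)

        -- The base points `e ζ` exceed ε and are closed under `bound`, so i lies between ε and the
        -- base point of the later block, where j is far.
        far-indices : ∀ {ζ ζ′} → ζ < ζ′ → ζ′ < μ →
                      ∀ {i j} → i ∈ w (index (e ζ)) → j ∈ w (index (e ζ′)) → n ℕ.≤ ρ i j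
        far-indices ζ<ζ′ ζ′<μ i∈w j∈w =
          let ζ<μ = <-trans ζ<ζ′ ζ′<μ
              _ , _ , _ , _ , w-spec = next-spec (e<μ ζ<μ)
              e<i , i<b , _ = w-spec i∈w
              _ , _ , _ , _ , w-spec′ = next-spec (e<μ ζ′<μ)
              _ , _ , j-far = w-spec′ j∈w
              ε<e = closurePoints-const (closurePoints-∨ʳ bound (λ _ → ε) (proj₁ (e-spec ζ<μ)))
          in j-far (<-trans ε<e e<i) (<-trans i<b (bound<e ζ<ζ′ ζ′<μ))

        far : ∀ {α β} → α ∈ X → β ∈ X → α < β → ∀ {i j} → i ∈ w α → j ∈ w β → n ℕ.≤ colour i j
        far (ζ , ζ<μ , refl) (ζ′ , ζ′<μ , refl) α<β {i} {j} i∈w j∈w with compare ζ ζ′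
        ... | tri< ζ<ζ′ _ _ = ℕₚ.m≤n⇒m≤n+o (ρ j i) (far-indices ζ<ζ′ ζ′<μ i∈w j∈w)
        ... | tri≈ _ refl _ = contradiction α<β (<-irrefl refl)
        ... | tri> _ _ ζ′<ζ = contradiction (inj₁ (index-mono ζ′<ζ ζ<μ)) (<⇒≱ α<β)

        assemble : Conclusion
        assemble = X , ((λ { (_ , ζ<μ , refl) → proj₁ (next-spec (e<μ ζ<μ)) })
                     , increasing⇒equinumerous index-mono) , far

      conclusion : Conclusion
      conclusion =
        let f , f-spec = choose (_< μ) Next (0# , 0#) next-exists
            g = (proj₂ ∘ f) ∨ᶠ (λ _ → ε)
            e , e-spec = enumerate {ClosurePoints g} proj₁ (closurePoints-unbounded
              (∨ᶠ-preserves (λ δ<μ → proj₁ (proj₂ (proj₂ (proj₂ (f-spec δ<μ))))) (λ _ → ε<μ)))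
        in assemble (proj₁ ∘ f) (proj₂ ∘ f) f-spec e e-spec

    conclude : (∃[ ε ] (ε < μ × (∀ {α} → α < μ → ∃[ γ ] (α ≤ γ × γ < μ × P ε γ))))
      ⊎ (∃ λ g → Preserves g × (∀ {γ ε} → γ ∈ ClosurePoints g → ε < γ → ¬ P ε γ)) → Conclusion
    conclude (inj₁ (ε , ε<μ , stationary)) = Spread.conclusion ε<μ stationary
    conclude (inj₂ (g , pg , ¬P)) = contradiction (near⇒trivial n pg near) ¬trivial
      where
      near : ∀ {α} → α < μ → ∃ (Near n g α)
      near {α} α<μ with beyond α<μ
      ... | ξ , ξ<μ , α≤ξ , α<w = elements ξ<μ
        , (λ x∈xs → let x∈w = ∈-elements⁻ ξ<μ x∈xs in inj₁ (α<w x∈w) , proj₁ (w-fin ξ<μ) x∈w)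
        -- If all points of `w ξ` were at least n steps from γ, so they would be from every δ just
        -- below γ; the largest of the finitely many thresholds then witnesses `P`, which pressing
        -- down excludes.
        , λ {γ} γ∈D γ<α → dne λ ¬close →
            let ε , ε<γ , spec = list-bounded
                  (λ ε j → ∀ {δ} → ε < δ → δ < γ → n ℕ.≤ ρ δ j)
                  (λ ε≤ε′ j-far ε′<δ → j-far (≤-<-trans ε≤ε′ ε′<δ))
                  (proj₁ (proj₁ (proj₂ γ∈D))) (elements ξ<μ)
                  λ {j} j∈xs →
                    let j∈w = ∈-elements⁻ ξ<μ j∈xs
                        ε , ε<γ , _ , _ , _ , tail = ρ-below-limit (proj₁ (proj₂ γ∈D)) j
                          (<-trans γ<α (α<w j∈w)) (proj₁ (w-fin ξ<μ) j∈w)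
                        n≤ρ = ℕₚ.≮⇒≥ λ ρ<n → ¬close (j , j∈xs , ρ<n)
                    in ε , ε<γ , λ ε<δ δ<γ → ℕₚ.≤-trans n≤ρ (proj₁ (tail ε<δ δ<γ))
            in ¬P γ∈D ε<γ (ξ , ξ<μ , ≤-trans (inj₁ γ<α) α≤ξ , λ j∈w →
                 <-trans γ<α (α<w j∈w) , spec (∈-elements⁺ ξ<μ j∈w))

-- Construction of nontrivial club sequences.

module Nontrivial (em : ∀ {a} → ExcludedMiddle a) {ℓ : Level} (W : WellOrder ℓ)
  (μ : WellOrder.Carrier W) (μ-reg : Ordinals.IsRegularUncountable W μ) where

  open Regular em W μ μ-reg

  NontrivialClubs : Set (Level.suc ℓ)
  NontrivialClubs = ∃ λ (C : Ord → Subset) → (∀ {β} → β < μ → IsClub β (C β)) × ¬ Trivial C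

  inaccessible⇒limit : ∀ {β} → IsInaccessible β → IsLimit β
  inaccessible⇒limit {β} (β-reg , _) =
    Regular.inhabited em W β β-reg , Regular.greater em W β β-reg

  Subsingleton : Subset → Set ℓ
  Subsingleton A = ∀ {x y} → x ∈ A → y ∈ A → x ≡ y

  Predecessor : Ord → Subset
  Predecessor β x = x < β × (∀ {y} → y < β → y ≤ x)

  predecessor-subsingleton : ∀ {β} → Subsingleton (Predecessor β)
  predecessor-subsingleton (x<β , ≤x) (y<β , ≤y) = ≤-antisym (≤y x<β) (≤x y<β)

  -- At β = 0 the set is empty and unboundedness is vacuous; a set with at most one point has no
  -- limit points.
  predecessor-club : ∀ {β} → ¬ IsLimit β → IsClub β (Predecessor β)
  predecessor-club {β} ¬lim = record
    { subset    = proj₁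
    ; unbounded = λ {γ} γ<β → dne λ none → ¬lim ((γ , γ<β) , λ {α} α<β → dne λ no-greater →
        let max : ∀ {y} → y < β → y ≤ α
            max y<β = ≮⇒≥ λ α<y → no-greater (_ , α<y , y<β)
        in none (α , (α<β , λ {y} → max {y}) , max γ<β))
    ; closed    = λ {α} α<β ((ε , ε<α) , _) sup →
        let x , (_ , ≤x) , _ , x<α = isSup-cofinal (Predecessor β) sup ε<α
        in contradiction (≤x α<β) (<⇒≱ x<α)
    }

  Between : Ord → Ord → Subset
  Between ε β x = ε < x × x < β

  between-club : ∀ {ε β} → IsLimit β → ε < β → IsClub β (Between ε β)
  between-club {ε} {β} β-lim ε<β = record
    { subset    = proj₂
    ; unbounded = λ {γ} γ<β → let x , <x , x<β = proj₂ β-lim (∨-lub ε<β γ<β) in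
        x , (≤-<-trans (x≤x∨y ε γ) <x , x<β) , inj₁ (≤-<-trans (y≤x∨y ε γ) <x)
    ; closed    = λ {α} α<β ((ε′ , ε′<α) , _) sup →
        let x , (ε<x , _) , _ , x<α = isSup-cofinal (Between ε β) sup ε′<α
        in <-trans ε<x x<α , α<β
    }

  -- The order type of A is at most θ, and θ lies below A.
  Thin : Subset → Set ℓ
  Thin A = ∃[ θ ] ((∀ {x} → x ∈ A → θ < x) × (∃ λ (p : Ord → Ord) →
    (∀ {x} → x ∈ A → p x < θ) × (∀ {x y} → x ∈ A → y ∈ A → x < y → p x < p y)))

  Singular : Ord → Set ℓ
  Singular β = ∃[ η ] (η < β × ∃ (IsCofinalMap η β))

  module CofinalitySequence {β θ : Ord} {f : Ord → Ord} (β-lim : IsLimit β) (θ<β : θ < β)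
    (f<β : ∀ {ε} → ε < θ → f ε < β) (f-cofinal : ∀ {γ} → γ < β → ∃[ ε ] (ε < θ × γ ≤ f ε))
    (θ-minimal : ∀ {η} → η < θ → ¬ ∃ (IsCofinalMap η β)) where

    Bound : Ord → Ord → Set ℓ
    Bound ε y = ∀ {ε′} → ε′ < ε → f ε′ < y

    bound<β : ∀ {ε} → ε < θ → ∃[ y ] (y < β × Bound ε y)
    bound<β ε<θ = ¬cofinal⇒bounded f (λ ε′<ε → f<β (<-trans ε′<ε ε<θ))
      λ cof → θ-minimal ε<θ (f , cof)

    -- `f` need not be monotone. The least strict bounds of its initial segments form a
    -- nondecreasing continuous sequence, whose range is closed; minimality of θ keeps them below β.
    σ : Ord → Ord
    σ ε = least μ (Bound ε)

    σ-isLeast : ∀ {ε} → ε < θ → IsLeast (Bound ε) (σ ε)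
    σ-isLeast ε<θ = let y , _ , b = bound<β ε<θ in least-isLeast μ (y , λ {ε′} → b {ε′})

    σ<β : ∀ {ε} → ε < θ → σ ε < β
    σ<β ε<θ = let _ , y<β , b = bound<β ε<θ in ≤-<-trans (proj₂ (σ-isLeast ε<θ) b) y<β

    σ-mono : ∀ {ε ε′} → ε ≤ ε′ → ε′ < θ → σ ε ≤ σ ε′
    σ-mono ε≤ε′ ε′<θ = proj₂ (σ-isLeast (≤-<-trans ε≤ε′ ε′<θ))
      λ ζ<ε → proj₁ (σ-isLeast ε′<θ) (<-≤-trans ζ<ε ε≤ε′)

    σ-cofinal : ∀ {γ} → γ < β → ∃[ ε ] (ε < θ × γ < σ ε)
    σ-cofinal {γ} γ<β = dne λ none →
      let ε , ε<θ , γ≤fε = f-cofinal γ<β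
          last : ∀ {ε′} → ε′ < θ → ε′ ≤ ε
          last ε′<θ = ≮⇒≥ λ ε<ε′ → none (_ , ε′<θ , ≤-<-trans γ≤fε (proj₁ (σ-isLeast ε′<θ) ε<ε′))
          -- Now ε is the last index, so a value of `f` above `f ε` comes from an earlier index and
          -- already lifts `σ ε` above γ.
          γ′ , fε<γ′ , γ′<β = proj₂ β-lim (f<β ε<θ)
          ε′ , ε′<θ , γ′≤fε′ = f-cofinal γ′<β
          fε<fε′ = <-≤-trans fε<γ′ γ′≤fε′
      in none (ε , ε<θ , (case-≤ (last ε′<θ)
           (λ ε′<ε → <-trans (≤-<-trans γ≤fε fε<fε′) (proj₁ (σ-isLeast ε<θ) ε′<ε))
           (λ ε′≡ε → contradiction fε<fε′ (<-irrefl (cong f (sym ε′≡ε))))))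
      where
      case-≤ : ∀ {x y} {B : Set ℓ} → x ≤ y → (x < y → B) → (x ≡ y → B) → B
      case-≤ (inj₁ x<y) l r = l x<y
      case-≤ (inj₂ x≡y) l r = r x≡y

    A : Subset
    A x = x < β × θ < x × (∃[ ε ] (ε < θ × σ ε ≡ x))

    club : IsClub β A
    club = record
      { subset    = proj₁
      ; unbounded = λ {γ} γ<β →
          let ε , ε<θ , <σ = σ-cofinal (∨-lub γ<β θ<β)
          in σ ε , (σ<β ε<θ , ≤-<-trans (y≤x∨y γ θ) <σ , ε , ε<θ , refl) , inj₁ (≤-<-trans (x≤x∨y γ θ) <σ)
      ; closed    = closed
      }
      where
      closed : ∀ {α} → α < β → IsLimit α → IsSup (Below α ∩ A) α → α ∈ A
      closed {α} α<β α-lim sup =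
        -- The first ε with α ≤ `σ ε` gives equality: for ε′ < ε some later `σ ε″` lies strictly
        -- between `σ ε′` and α, so `f ε′` is below α.
        let ε , (ε<θ , α≤σ) , least-ε = ∃-least {P = λ ε → ε < θ × α ≤ σ ε}
              (let ε , ε<θ , α<σ = σ-cofinal α<β in ε , ε<θ , inj₁ α<σ)
            σ<α : ∀ {ε′} → ε′ < ε → σ ε′ < α
            σ<α ε′<ε = ≰⇒> λ α≤σ′ → <⇒≱ ε′<ε (least-ε (<-trans ε′<ε ε<θ , α≤σ′))
            _ , (_ , θ<x , _) , _ , x<α = isSup-cofinal A sup (proj₂ (proj₁ α-lim))
        in α<β , <-trans θ<x x<α , ε , ε<θ
         , ≤-antisym (proj₂ (σ-isLeast ε<θ) (f<α ε<θ σ<α)) α≤σ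
        where
        f<α : ∀ {ε} → ε < θ → (∀ {ε′} → ε′ < ε → σ ε′ < α) → Bound ε α
        f<α ε<θ σ<α {ε′} ε′<ε with isSup-cofinal A sup (σ<α ε′<ε)
        ... | _ , (_ , _ , ε″ , ε″<θ , refl) , σε′<σε″ , σε″<α =
          <-trans (proj₁ (σ-isLeast ε″<θ) (≰⇒> λ ε″≤ε′ →
            <⇒≱ σε′<σε″ (σ-mono ε″≤ε′ (<-trans ε′<ε ε<θ)))) σε″<α

    A-thin : Thin A
    A-thin =
      let p , p-spec = choose (_∈ A) (λ x ε → ε < θ × σ ε ≡ x) μ (proj₂ ∘ proj₂)
      in θ , proj₁ ∘ proj₂ , p , proj₁ ∘ p-spec , λ {x} {y} x∈A y∈A x<y → ≰⇒> λ py≤px →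
         let px<θ , σpx≡x = p-spec x∈A
             _ , σpy≡y = p-spec y∈A
         in <⇒≱ x<y (subst (_≤ x) σpy≡y (subst (σ (p y) ≤_) σpx≡x (σ-mono py≤px px<θ)))

  singular⇒thin-club : ∀ {β} → IsLimit β → Singular β → ∃ λ A → IsClub β A × Thin A
  singular⇒thin-club {β} β-lim (η , η<β , η-cofinal) =
    let θ , (f , f<β , f-cofinal) , least-θ = ∃-least {P = λ θ → ∃ (IsCofinalMap θ β)} (η , η-cofinal)
        open CofinalitySequence {f = f} β-lim (≤-<-trans (least-θ η-cofinal) η<β) f<β f-cofinal
          (λ η<θ cof → <⇒≱ η<θ (least-θ cof))
    in A , club , A-thin

  -- The shapes of the chosen club A of β: if it captures enough closure
  -- points of some g and β is large, only the first shape is possible.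
  data Shape (C : Ord → Subset) (β : Ord) (A : Subset) : Set (Level.suc ℓ) where
    inaccessible : IsInaccessible β → A ⊆ C β → Shape C β A
    subsingleton : Subsingleton A → Shape C β A
    thin         : Thin A → Shape C β A
    successor    : ∀ κ → IsCardinal β → (∀ {x} → x ∈ A → κ < x) →
                   (∀ {ν} → IsCardinal ν → κ < ν → ¬ ν < β) → Shape C β A
    countable    : ¬ IsUncountable β → ¬ Singular β → Shape C β A

  nonsingular⇒cardinal : ∀ {β} → ¬ Singular β → IsCardinal β
  nonsingular⇒cardinal ¬sing μ′<β (f , f<β , _ , onto) =
    ¬sing (_ , μ′<β , f , f<β , λ γ<β → let ε , ε<μ′ , fε≡γ = onto γ<β in ε , ε<μ′ , inj₂ (sym fε≡γ))

  ∃-shaped-club : ∀ {C : Ord → Subset} → IsClubSequence (Sᵢₙ μ) C → ∀ {β} → β < μ →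
                  ∃ λ A → IsClub β A × Shape C β A
  ∃-shaped-club {C} C-club {β} β<μ with em {P = IsLimit β}
  ... | no ¬lim = Predecessor β , predecessor-club ¬lim , subsingleton predecessor-subsingleton
  ... | yes lim with em {P = Singular β}
  ...   | yes sing = let A , club , A-thin = singular⇒thin-club lim sing in A , club , thin A-thin
  ...   | no ¬sing with em {P = IsUncountable β}
  ...     | no count = Between (proj₁ (proj₁ lim)) β , between-club lim (proj₂ (proj₁ lim)) , countable count ¬sing
  ...     | yes uncount with em {P = IsLimitCardinal β}
  ...       | yes β-limc = C β , C-club (β<μ , inacc) , inaccessible inacc λ x∈C → x∈C
    where
    inacc : IsInaccessible β
    inacc = ((λ {μ′} → nonsingular⇒cardinal ¬sing {μ′}) , uncount
          , ((λ ε → ε) , (λ ε<β → ε<β) , λ γ<β → _ , γ<β , ≤-refl) , λ η<β cof → ¬sing (_ , η<β , cof))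
          , β-limc
  -- Here β is a successor cardinal: regular but not a limit, so some κ has no cardinal strictly
  -- between itself and β.
  ...       | no ¬β-limc =
    let κ , κ<β , none = predecessor-cardinal
    in Between κ β , between-club lim κ<β
     , successor κ (nonsingular⇒cardinal ¬sing) proj₁ λ ν-card κ<ν ν<β → none (_ , ν-card , κ<ν , ν<β)
    where
    predecessor-cardinal : ∃[ κ ] (κ < β × ¬ (∃[ ν ] (IsCardinal ν × κ < ν × ν < β)))
    predecessor-cardinal = dne λ none → ¬β-limc ((λ {μ′} → nonsingular⇒cardinal ¬sing {μ′}) ,
      λ {κ} κ<β _ → dne λ no-ν → none (κ , κ<β , no-ν))

  NontrivialAtInaccessibles : (Ord → Subset) → Set ℓ
  NontrivialAtInaccessibles C = ∀ g → Preserves g → ∃[ α ] (α < μ ×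
    (∀ {β} → IsInaccessible β → α ≤ β → β < μ → ¬ Captures (C β) g α))

  captures-⊆ : ∀ {A B g α α′} → A ⊆ B → α ≤ α′ → Captures A g α′ → Captures B g α
  captures-⊆ A⊆B α≤α′ cap γ∈D γ<α = A⊆B (cap γ∈D (<-≤-trans γ<α α≤α′))

  -- `A` contains m and all `e ζ` with ζ ≤ m. A thin `A` has θ < m, yet the first m values of `e`
  -- would embed m into θ. In the successor case κ < m ≤ ν < β for a cardinal ν. A countable β above
  -- `ω` would be singular.
  shape-refutes-capture : ∀ {C g αᵢ m ν α β A} {e : Ord → Ord} →
    (IsInaccessible β → ¬ Captures (C β) g αᵢ) → αᵢ ≤ α →
    m ∈ ClosurePoints g → m < α →
    (∀ {ζ} → ζ < μ → e ζ ∈ ClosurePoints g × (∀ {ζ′} → ζ′ < ζ → e ζ′ < e ζ)) → e m < α →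
    (IsCardinal β → IsCardinal ν × m ≤ ν) → ν < α → ω < α →
    α ≤ β → Captures A g α → ¬ Shape C β A
  shape-refutes-capture {C} {g} {αᵢ} {m} {ν} {α} {β} {A} {e}
    ¬capturesᵢ αᵢ≤α m∈D m<α e-spec e<α large ν<α ω<α α≤β captures = refute
    where
    m<μ : m < μ
    m<μ = proj₁ m∈D
    e-mono : ∀ {ζ ζ′} → ζ < ζ′ → ζ′ < μ → e ζ < e ζ′
    e-mono ζ<ζ′ ζ′<μ = proj₂ (e-spec ζ′<μ) ζ<ζ′
    e∈A : ∀ {ζ} → ζ < m → e ζ ∈ A
    e∈A ζ<m = captures (proj₁ (e-spec (<-trans ζ<m m<μ))) (<-trans (e-mono ζ<m m<μ) e<α)

    refute : ¬ Shape C β A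
    refute (inaccessible β-inacc A⊆C) = ¬capturesᵢ β-inacc λ γ∈D γ<αᵢ →
      A⊆C (captures γ∈D (<-≤-trans γ<αᵢ αᵢ≤α))
    refute (subsingleton unique) =
      let _ , x<m = proj₁ (proj₁ (proj₂ m∈D))
      in <-irrefl (unique (e∈A x<m) (captures (proj₁ (e-spec m<μ)) e<α)) (e-mono x<m m<μ)
    refute (thin (θ , θ< , p , p<θ , p-mono)) = <⇒≱ (p<θ (e∈A θ<m)) (θ≤p θ θ<m)
      where
      θ<m = θ< (captures m∈D m<α)
      -- An increasing map dominates the identity; at ζ = θ this contradicts `p<θ`.
      θ≤p : ∀ ζ → ζ < m → ζ ≤ p (e ζ)
      θ≤p = <-rec _ λ ζ ih ζ<m → ≮⇒≥ λ p<ζ →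
        let p<m = <-trans p<ζ ζ<m
        in <⇒≱ (p-mono (e∈A p<m) (e∈A ζ<m) (e-mono p<ζ (<-trans ζ<m m<μ))) (ih p<ζ p<m)
    refute (successor κ β-card κ< none) =
      none {ν} (proj₁ (large β-card)) (<-≤-trans (κ< (captures m∈D m<α)) (proj₂ (large β-card)))
        (<-≤-trans ν<α α≤β)
    refute (countable β-count ¬sing) =
      ¬sing (ω , <-≤-trans ω<α α≤β , countable⇒cofinal (<-≤-trans ω<α α≤β) β-count)

  -- If no cardinal in [m, μ) exists, ν = m works vacuously, since no β in (m, μ) is a cardinal.
  large-cardinal : ∀ {m} → m < μ →
    ∃[ ν ] (ν < μ × (∀ {β} → β < μ → ν < β → IsCardinal β → IsCardinal ν × m ≤ ν))
  large-cardinal {m} m<μ with em {P = ∃[ ν ] (ν < μ × IsCardinal ν × m ≤ ν)}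
  ... | yes (ν , ν<μ , ν-large) = ν , ν<μ , λ _ _ _ → ν-large
  ... | no none = m , m<μ , λ {β} β<μ m<β β-card →
    contradiction (β , β<μ , (λ {μ′} → β-card {μ′}) , inj₁ m<β) none

  -- Take a closure point m beyond `αᵢ` and capture up to an α above m, `e m`, ν and `ω`; this
  -- excludes every shape but the inaccessible one.
  captured-at-inaccessible : ∀ {C C′ : Ord → Subset} {g} → Preserves g → (∀ {β} → β < μ → Shape C β (C′ β)) →
    (∀ {α} → α < μ → ∃[ β ] (α ≤ β × β < μ × Captures (C′ β) g α)) → ∀ {α} → α < μ →
    ∃[ β ] (IsInaccessible β × α ≤ β × β < μ × Captures (C β) g α)
  captured-at-inaccessible {C} {C′} {g} pg shape captured {αᵢ} αᵢ<μ = dne (refute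
      (closurePoints-unbounded pg αᵢ<μ) (enumerate {ClosurePoints g} proj₁ (closurePoints-unbounded pg)))
    where
    below : ∀ {xs} → All (_< μ) xs → ∀ {x} → x ∈ˡ xs → ∃[ α ] (α < μ × x < α)
    below xs<μ x∈xs = let α , x<α , α<μ = greater (lookup xs<μ x∈xs) in α , α<μ , x<α

    bound : ∀ {xs} → All (_< μ) xs → ∃[ α ] (α < μ × (∀ {x} → x ∈ˡ xs → x < α))
    bound {xs} xs<μ =
      list-bounded (λ α x → x < α) (λ α≤α′ x<α → <-≤-trans x<α α≤α′) inhabited xs (below xs<μ)

    refute : ∃[ m ] (m ∈ ClosurePoints g × αᵢ < m) →
      (∃ λ (e : Ord → Ord) → ∀ {ζ} → ζ < μ → e ζ ∈ ClosurePoints g × (∀ {ζ′} → ζ′ < ζ → e ζ′ < e ζ)) →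
      ¬ ¬ (∃[ β ] (IsInaccessible β × αᵢ ≤ β × β < μ × Captures (C β) g αᵢ))
    refute (m , m∈D , αᵢ<m) (e , e-spec) none =
      conclude (large-cardinal (proj₁ m∈D))
      where
      conclude : ∃[ ν ] (ν < μ × (∀ {β} → β < μ → ν < β → IsCardinal β → IsCardinal ν × m ≤ ν)) → ⊥
      conclude (ν , ν<μ , large) = shaped (bound
        (proj₁ m∈D ∷ proj₁ (proj₁ (e-spec (proj₁ m∈D))) ∷ ν<μ ∷ ω<μ ∷ []))
        where
        shaped : ∃[ α ] (α < μ × (∀ {x} → x ∈ˡ (m ∷ e m ∷ ν ∷ ω ∷ []) → x < α)) → ⊥
        shaped (α , α<μ , <α) =
          let β , α≤β , β<μ , captures = captured α<μ
              αᵢ<α = <-trans αᵢ<m (<α (here refl))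
              ν<α = <α (there (there (here refl)))
          in shape-refutes-capture {e = e}
               (λ β-inacc capturesᵢ → none (β , β-inacc , ≤-trans (inj₁ αᵢ<α) α≤β , β<μ , capturesᵢ))
               (inj₁ αᵢ<α) m∈D (<α (here refl)) e-spec (<α (there (here refl)))
               (large β<μ (<-≤-trans ν<α α≤β)) ν<α (<α (there (there (there (here refl)))))
               α≤β captures (shape β<μ)

  extend-nontrivial : ∀ {C} → IsClubSequence (Sᵢₙ μ) C → NontrivialAtInaccessibles C → NontrivialClubs
  extend-nontrivial {C} C-club C-nontrivial =
    let C′ , C′-spec = choose (_< μ) (λ β A → IsClub β A × Shape C β A) (Below μ) (∃-shaped-club C-club)
    in C′ , proj₁ ∘ C′-spec , λ (g , pg , captured) →
       let α , α<μ , ¬captures = C-nontrivial g pg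
           β , β-inacc , α≤β , β<μ , captures =
             captured-at-inaccessible {C} {C′} pg (λ β<μ → proj₂ (C′-spec β<μ)) captured α<μ
       in ¬captures β-inacc α≤β β<μ captures

  -- Provides a nonzero length ζ for a cover by a single club.
  two-below-ℵ₀ : ∀ {κ} → IsAleph₀ κ → ∃[ ζ ] (ζ < κ × ∃[ ε ] ε < ζ)
  two-below-ℵ₀ (_ , f , _ , _ , onto) with onto {0} _ | onto {1} _
  ... | x , x<κ , fx≡0 | y , y<κ , fy≡1 with compare x y
  ...   | tri< x<y _ _ = y , y<κ , x , x<y
  ...   | tri> _ _ y<x = x , x<κ , y , y<x
  ...   | tri≈ _ refl _ with trans (sym fx≡0) fy≡1
  ...     | ()

  captures⇒almostCovered : ∀ {κ} (S : Subset) (C : Ord → Subset) {A g δ β} → IsAleph₀ κ → β ∈ S → IsLimit δ → Captures (C β) g δ →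
                           A ⊆ ClosurePoints g → AlmostCovered κ S C A δ
  captures⇒almostCovered S C {β = β} κ-ℵ₀ β∈S ((γ , γ<δ) , _) captures A⊆D =
    let ζ , ζ<κ , ε , ε<ζ = two-below-ℵ₀ κ-ℵ₀
    in ζ , ζ<κ , (λ _ → β) , (λ _ → β∈S) , γ , γ<δ , λ (x∈A , x<δ , uncovered) →
       contradiction (ε , ε<ζ , captures (A⊆D x∈A) x<δ) uncovered

  ⊕⇒nontrivial : ∀ {κ} → IsAleph₀ κ → ⊕ κ μ → NontrivialClubs
  ⊕⇒nontrivial {κ} κ-ℵ₀ (C , C-club , C-⊕) = clubs (choose (_< μ) (λ β A → IsClub β A × Kind β A)
      (Below μ) exists)
    where
    Kind : Ord → Subset → Set ℓ
    Kind β A = IsLimit β × A ⊆ C β ⊎ Subsingleton A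

    exists : ∀ {β} → β < μ → ∃ λ A → IsClub β A × Kind β A
    exists {β} β<μ with em {P = IsLimit β}
    ... | yes lim = C β , C-club (β<μ , lim) , inj₁ (lim , λ x∈C → x∈C)
    ... | no ¬lim = Predecessor β , predecessor-club ¬lim , inj₂ predecessor-subsingleton

    clubs : (∃ λ (C′ : Ord → Subset) → ∀ {β} → β < μ → IsClub β (C′ β) × Kind β (C′ β)) → NontrivialClubs
    clubs (C′ , C′-spec) = C′ , proj₁ ∘ C′-spec , nontrivial
      where
      nontrivial : ¬ Trivial C′
      nontrivial (g , pg , captured) with C-⊕ (ClosurePoints g) (closurePoints-club pg)
      ... | δ , ((δ<μ , lim , _) , sup) , _ , ¬covered with captured δ<μ
      ...   | β , δ≤β , β<μ , captures with proj₂ (C′-spec β<μ)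
      ...     | inj₁ (β-lim , C′⊆C) = ¬covered (captures⇒almostCovered (Sₗᵢₘ μ) C κ-ℵ₀ (β<μ , β-lim) lim
        (captures-⊆ {B = C β} {g} C′⊆C ≤-refl captures) proj₂)
      ...     | inj₂ unique =
        let x , x∈D , _ , x<δ = isSup-cofinal (ClosurePoints g) sup (proj₂ (proj₁ lim))
            y , y∈D , x<y , y<δ = isSup-cofinal (ClosurePoints g) sup x<δ
        in <-irrefl (unique (captures x∈D x<δ) (captures y∈D y<δ)) x<y

  ⊗⇒nontrivial : ∀ {κ} → IsAleph₀ κ → ⊗ κ μ → NontrivialClubs
  ⊗⇒nontrivial κ-ℵ₀ (C , C-club , C-⊗) = extend-nontrivial C-club λ g pg →
    let δ , ((_ , lim , _) , _) , (δ<μ , _) , _ , ¬covered = C-⊗ (ClosurePoints g) (closurePoints-club pg)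
    in δ , δ<μ , λ β-inacc δ≤β β<μ captures →
         ¬covered (captures⇒almostCovered (Sᵢₙ μ) C κ-ℵ₀ (β<μ , β-inacc) lim captures proj₁)

  -- If μ is not a limit cardinal, the inaccessibles below it are bounded and their clubs do not
  -- matter. Otherwise some club `E` misses the inaccessibles; `E` is bounded below each of them, so
  -- `C β` can start past `E` and captures no point of a club inside `E`.
  ¬mahlo⇒nontrivial : ¬ IsMahlo μ → NontrivialClubs
  ¬mahlo⇒nontrivial ¬mahlo with em {P = IsLimitCardinal μ}
  ... | no ¬limc = extend-nontrivial {λ β → Below β} below-club λ g pg →
    let κ , κ<μ , none = predecessor-cardinal
        α , κ<α , α<μ = greater κ<μ
    in α , α<μ , λ ((β-card , _) , _) α≤β β<μ _ → none (_ , β-card , <-≤-trans κ<α α≤β , β<μ)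
    where
    predecessor-cardinal : ∃[ κ ] (κ < μ × ¬ (∃[ ν ] (IsCardinal ν × κ < ν × ν < μ)))
    predecessor-cardinal = dne λ none → ¬limc ((λ {μ′} → proj₁ μ-reg {μ′}) ,
      λ {κ} κ<μ _ → dne λ no-ν → none (κ , κ<μ , no-ν))
    below-club : IsClubSequence (Sᵢₙ μ) (λ β → Below β)
    below-club _ = record
      { subset = λ x<δ → x<δ ; unbounded = λ γ<δ → _ , γ<δ , ≤-refl ; closed = λ α<δ _ _ → α<δ }
  ... | yes limc = avoid (dne λ none → ¬mahlo ((μ-reg , limc) , proj₁ , λ E E-club →
          dne λ disjoint → none (E , E-club , λ {β} β∈S β∈E → disjoint (β , β∈S , β∈E))))
    where
    avoid : (∃ λ E → IsClub μ E × (∀ {β} → β ∈ Sᵢₙ μ → β ∉ E)) → NontrivialClubs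
    avoid (E , E-club , S∌E) = extend-nontrivial {λ β → Between (gap-start β) β}
        (λ {β} β∈S → between-club (inaccessible⇒limit (proj₂ β∈S)) (proj₁ (gap-spec β∈S)))
        λ g pg →
          let h , ph , D⊆E = club-contains-closurePoints E-club
              γ , γ∈D , _ = closurePoints-unbounded (∨ᶠ-preserves pg ph) (proj₂ inhabited)
              α , γ<α , α<μ = greater (proj₁ γ∈D)
          in α , α<μ , λ β-inacc α≤β β<μ captures →
               let ε<γ , γ<β = captures (closurePoints-∨ˡ g h γ∈D) γ<α
               in proj₂ (gap-spec (β<μ , β-inacc)) (D⊆E (closurePoints-∨ʳ g h γ∈D)) ε<γ γ<β
      where
      gap : ∃ λ (start : Ord → Ord) → ∀ {β} → β ∈ Sᵢₙ μ →
              start β < β × (∀ {x} → x ∈ E → start β < x → ¬ x < β)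
      gap = choose (_∈ Sᵢₙ μ) (λ β ε → ε < β × (∀ {x} → x ∈ E → ε < x → ¬ x < β)) μ
        λ {β} β∈S → club-gap E-club (inaccessible⇒limit (proj₂ β∈S)) (proj₁ β∈S) (S∌E β∈S)
      gap-start = proj₁ gap
      gap-spec : ∀ {β} → β ∈ Sᵢₙ μ → gap-start β < β × (∀ {x} → x ∈ E → gap-start β < x → ¬ x < β)
      gap-spec = proj₂ gap

  nontrivialClubs : (¬ IsMahlo μ ⊎ (IsMahlo μ × (∃[ ℵ₀ ] (IsAleph₀ ℵ₀ × (⊗ ℵ₀ μ ⊎ ⊕ ℵ₀ μ))))) → NontrivialClubs
  nontrivialClubs (inj₁ ¬mahlo)                          = ¬mahlo⇒nontrivial ¬mahlo
  nontrivialClubs (inj₂ (_ , _ , κ-ℵ₀ , inj₁ μ-⊗)) = ⊗⇒nontrivial κ-ℵ₀ μ-⊗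
  nontrivialClubs (inj₂ (_ , _ , κ-ℵ₀ , inj₂ μ-⊕)) = ⊕⇒nontrivial κ-ℵ₀ μ-⊕

-- From families of finite sets to subsets of full size.

module HomogeneousSets (em : ∀ {a} → ExcludedMiddle a) {ℓ : Level} (W : WellOrder ℓ)
  (μ : WellOrder.Carrier W) (μ-reg : Ordinals.IsRegularUncountable W μ) where

  open Regular em W μ μ-reg

  ∃-minimum : ∀ {p} {P : ℕ → Set p} → ∃ P → ∃ (IsMinimum P)
  ∃-minimum {P = P} (x , Px) = dne λ none →
    ℕ-rec (λ n → ¬ P n) (λ n ih Pn → none (n , Pn , λ {k} Pk → ℕₚ.≮⇒≥ λ k<n → ih k<n Pk)) x Px

  SeparatesFamilies : (Ord → Ord → ℕ) → Set (Level.suc ℓ)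
  SeparatesFamilies c = ∀ (w : Ord → Subset) →
    (∀ {α} → α < μ → w α ⊆ Below μ × Finite (w α)) → PairwiseDisjoint (Below μ) w → ∀ n →
    ∃ λ (X : Subset) → (X ∈ ([ Below μ ]^ μ)
      × (∀ {α β} → α ∈ X → β ∈ X → α < β → ∀ {i j} → i ∈ w α → j ∈ w β → n ℕ.≤ c i j))

  -- Applied to the singletons of an enumeration of `A`, with `suc n` for the strict bound; the
  -- minimum exists because `B` has two distinct points.
  separates⇒min-range : ∀ {c} → (∀ i j → c i j ≡ c j i) → SeparatesFamilies c →
    ∀ (A : Subset) → A ∈ ([ Below μ ]^ μ) → ∀ n →
    ∃ λ (B : Subset) → (B ∈ ([ A ]^ μ) × (∃[ m ] (IsMinimum (RangeOnPairs c B) m × n ℕ.< m)))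
  separates⇒min-range {c} c-sym separates A (A⊆μ , f , f∈A , f-inj , _) n = from-separated
      (separates (λ α x → x ≡ f α)
        (λ {α} α<μ → (λ { refl → A⊆μ (f∈A α<μ) }) , f α ∷ [] , λ { refl → here refl })
        (λ α<μ β<μ α≢β x≡fα x≡fβ → α≢β (f-inj α<μ β<μ (trans (sym x≡fα) x≡fβ))) (suc n))
    where
    from-separated : (∃ λ (X : Subset) → (X ∈ ([ Below μ ]^ μ)
        × (∀ {α β} → α ∈ X → β ∈ X → α < β → ∀ {i j} → i ≡ f α → j ≡ f β → suc n ℕ.≤ c i j))) →
      ∃ λ (B : Subset) → (B ∈ ([ A ]^ μ) × (∃[ m ] (IsMinimum (RangeOnPairs c B) m × n ℕ.< m)))
    from-separated (X , (X⊆μ , h , h∈X , h-inj , h-onto) , far) =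
      let m , m∈range , m-min = ∃-minimum range-inhabited
      in B , ((λ { (_ , α∈X , refl) → f∈A (X⊆μ α∈X) })
             , f ∘ h , (λ x<μ → h _ , h∈X x<μ , refl) , fh-inj
             , λ { (_ , α∈X , refl) → let x , x<μ , hx≡α = h-onto α∈X in x , x<μ , cong f hx≡α })
         , m , (m∈range , m-min) , range> m∈range
      where
      B : Subset
      B x = ∃[ α ] (α ∈ X × f α ≡ x)

      fh-inj : ∀ {x y} → x < μ → y < μ → f (h x) ≡ f (h y) → x ≡ y
      fh-inj x<μ y<μ eq = h-inj x<μ y<μ (f-inj (X⊆μ (h∈X x<μ)) (X⊆μ (h∈X y<μ)) eq)

      range-inhabited : ∃ (RangeOnPairs c B)
      range-inhabited =
        let x , x<μ = inhabited
            y , x<y , y<μ = greater x<μ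
        in _ , f (h x) , f (h y) , (h x , h∈X x<μ , refl) , (h y , h∈X y<μ , refl)
             , (λ eq → <-irrefl (fh-inj x<μ y<μ eq) x<y) , refl

      range> : ∀ {k} → k ∈ RangeOnPairs c B → n ℕ.< k
      range> (_ , _ , (α , α∈X , refl) , (β , β∈X , refl) , fα≢fβ , refl) with compare α β
      ... | tri< α<β _ _ = far α∈X β∈X α<β refl refl
      ... | tri≈ _ refl _ = contradiction refl fα≢fβ
      ... | tri> _ _ β<α = subst (n ℕ.<_) (c-sym (f β) (f α)) (far β∈X α∈X β<α refl refl)

mainTheorem2 : (∀ {a} → ExcludedMiddle a) → ∀ {ℓ} (W : WellOrder ℓ) → let open Ordinals W in
    ∀ (μ : Ord) → IsRegularUncountable μ →
    (¬ IsMahlo μ ⊎ (IsMahlo μ × (∃[ ℵ₀ ] (IsAleph₀ ℵ₀ × (⊗ ℵ₀ μ ⊎ ⊕ ℵ₀ μ))))) →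
    ∃ λ (c : Ord → Ord → ℕ) → (IsPairColouring μ c
    × (∀ (A : Subset) → A ∈ ([ Below μ ]^ μ) → ∀ (n : ℕ) →
    ∃ λ (B : Subset) → (B ∈ ([ A ]^ μ) × (∃[ m ] (IsMinimum (RangeOnPairs c B) m × n ℕ.< m))))
    × (∀ (w : Ord → Subset) →
    (∀ {α} → α < μ → w α ⊆ Below μ × Finite (w α)) →
    PairwiseDisjoint (Below μ) w → ∀ (n : ℕ) →
    ∃ λ (X : Subset) → (X ∈ ([ Below μ ]^ μ)
    × (∀ {α β} → α ∈ X → β ∈ X → α < β →
    ∀ {i j} → i ∈ w α → j ∈ w β → n ℕ.≤ c i j))))
mainTheorem2 em W μ μ-reg hypothesis =
  let C , C-club , ¬trivial = nontrivialClubs hypothesis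
      open Colouring em W μ μ-reg C C-club
      separates = colour-unbounded ¬trivial
  in colour , (λ {i} {j} _ _ _ → colour-sym i j)
   , separates⇒min-range {colour} colour-sym separates , separates
  where
  open Nontrivial em W μ μ-reg
  open HomogeneousSets em W μ μ-reg
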